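{- For every natural number $n\ge 1$ there exist real square matrices $F$ and $H$ of order $2(n-1)$ such that the matrix pencil $F+\alpha H$ has $n$ disconnected stable regions with respect to the real parameter $\alpha$.
   Context: A square matrix is called stable if all of its eigenvalues have strictly negative real part. For real square matrices $F,H$ of the same order, the stability region (synchronized region) of the pencil $F+\alpha H$ is the set $S=\{\alpha\in\mathbb{R}:\ \alpha<0,\ F+\alpha H \text{ is stable}\}$. The pencil is said to have $k$ disconnected stable regions with respect to $\alpha$ if $S$ consists of $k$ connected components (maximal intervals). For $n=1$ the matrices are the empty $0\times 0$ matrices, which are regarded as stable. -}

module Defs where

open import Data.Empty using (⊥)
open import Data.Fin.Base using (Fin)
open import Data.Nat.Base as ℕ using (ℕ)
import Data.Nat.Properties as ℕₚ
open import Data.Product using (_×_; _,_; ∃-syntax; proj₁; proj₂)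
open import Data.Rational.Base as ℚ using (ℚ; 0ℚ; 1ℚ; ½; ∣_∣; 1/_)
import Data.Rational.Properties as ℚₚ
open import Data.Rational.Solver using (module +-*-Solver)
open import Data.Vec.Functional using (Vector; foldr)
open import Level using (0ℓ)
open import Relation.Binary.PropositionalEquality
  using (_≡_; _≢_; refl; sym; trans; cong; subst)
open import Relation.Nullary using (¬_)
open import Relation.Unary using (Pred; _∈_; _⊆_; Satisfiable)

------------------------------------------------------------------------
-- Real numbers: Cauchy sequences of rationals, with equality _≈_ meaning
-- that the difference is a null sequence.  The existentials carry the
-- moduli, so all operations can be defined pointwise.

Eventually : Pred ℕ 0ℓ → Set
Eventually P = ∃[ N ] (∀ n → N ℕ.≤ n → P n)

IsCauchy : (ℕ → ℚ) → Set
IsCauchy x = ∀ ε → 0ℚ ℚ.< ε →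
  ∃[ N ] (∀ m n → N ℕ.≤ m → N ℕ.≤ n → ∣ x m ℚ.- x n ∣ ℚ.< ε)

record ℝ : Set where
  constructor mkℝ
  field
    seq    : ℕ → ℚ
    cauchy : IsCauchy seq

open ℝ public

infix 4 _≈_ _<_ _≤_

_≈_ : ℝ → ℝ → Set
x ≈ y = ∀ ε → 0ℚ ℚ.< ε → Eventually λ n → ∣ seq x n ℚ.- seq y n ∣ ℚ.< ε

_<_ : ℝ → ℝ → Set
x < y = ∃[ ε ] (0ℚ ℚ.< ε × Eventually λ n → seq x n ℚ.+ ε ℚ.< seq y n)

_≤_ : ℝ → ℝ → Set
x ≤ y = ¬ (y < x)

private
  open +-*-Solver

  ½+½ : ∀ p → ½ ℚ.* p ℚ.+ ½ ℚ.* p ≡ p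
  ½+½ = solve 1 (λ p → con ½ :* p :+ con ½ :* p := p) refl

  recentre : ∀ p q → p ≡ (p ℚ.- q) ℚ.+ q
  recentre = solve 2 (λ p q → p := (p :- q) :+ q) refl

  neg-diff : ∀ p q → ℚ.- (p ℚ.- q) ≡ (ℚ.- p) ℚ.- (ℚ.- q)
  neg-diff = solve 2 (λ p q → :- (p :- q) := (:- p) :- (:- q)) refl

  add-diff : ∀ p q r s → (p ℚ.+ q) ℚ.- (r ℚ.+ s) ≡ (p ℚ.- r) ℚ.+ (q ℚ.- s)
  add-diff = solve 4 (λ p q r s → (p :+ q) :- (r :+ s) := (p :- r) :+ (q :- s)) refl

  mul-diff : ∀ p q r s →
             p ℚ.* q ℚ.- r ℚ.* s ≡ p ℚ.* (q ℚ.- s) ℚ.+ s ℚ.* (p ℚ.- r)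
  mul-diff = solve 4 (λ p q r s → p :* q :- r :* s := p :* (q :- s) :+ s :* (p :- r)) refl

  half-pos : ∀ {ε} → 0ℚ ℚ.< ε → 0ℚ ℚ.< ½ ℚ.* ε
  half-pos {ε} 0<ε =
    subst (ℚ._< ½ ℚ.* ε) (ℚₚ.*-zeroʳ ½) (ℚₚ.*-monoʳ-<-pos ½ 0<ε)

  EventuallyBounded : (ℕ → ℚ) → Set
  EventuallyBounded x = ∃[ B ] (0ℚ ℚ.< B × Eventually λ n → ∣ x n ∣ ℚ.< B)

  bounded : ∀ x → IsCauchy x → EventuallyBounded x
  bounded x cx with cx 1ℚ (ℚₚ.positive⁻¹ 1ℚ)
  ... | N , close = 1ℚ ℚ.+ ∣ x N ∣ , 0<B , N , bound
    where
    0<B : 0ℚ ℚ.< 1ℚ ℚ.+ ∣ x N ∣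
    0<B = ℚₚ.+-mono-<-≤ (ℚₚ.positive⁻¹ 1ℚ) (ℚₚ.0≤∣p∣ (x N))

    bound : ∀ n → N ℕ.≤ n → ∣ x n ∣ ℚ.< 1ℚ ℚ.+ ∣ x N ∣
    bound n N≤n = begin-strict
      ∣ x n ∣                           ≡⟨ cong ∣_∣ (recentre (x n) (x N)) ⟩
      ∣ (x n ℚ.- x N) ℚ.+ x N ∣         ≤⟨ ℚₚ.∣p+q∣≤∣p∣+∣q∣ (x n ℚ.- x N) (x N) ⟩
      ∣ x n ℚ.- x N ∣ ℚ.+ ∣ x N ∣       <⟨ ℚₚ.+-monoˡ-< ∣ x N ∣ (close n N N≤n ℕₚ.≤-refl) ⟩
      1ℚ ℚ.+ ∣ x N ∣                    ∎
      where open ℚₚ.≤-Reasoning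

  const-cauchy : ∀ q → IsCauchy (λ _ → q)
  const-cauchy q ε 0<ε =
    0 , λ _ _ _ _ → subst (λ d → ∣ d ∣ ℚ.< ε) (sym (ℚₚ.+-inverseʳ q)) 0<ε

  neg-cauchy : ∀ x → IsCauchy x → IsCauchy (λ n → ℚ.- x n)
  neg-cauchy x cx ε 0<ε with cx ε 0<ε
  ... | N , close = N , λ m n N≤m N≤n → subst (ℚ._< ε) (eq m n) (close m n N≤m N≤n)
    where
    eq : ∀ m n → ∣ x m ℚ.- x n ∣ ≡ ∣ (ℚ.- x m) ℚ.- (ℚ.- x n) ∣
    eq m n = trans (sym (ℚₚ.∣-p∣≡∣p∣ (x m ℚ.- x n)))
      (cong ∣_∣ (neg-diff (x m) (x n)))

  add-cauchy : ∀ x y → IsCauchy x → IsCauchy y → IsCauchy (λ n → x n ℚ.+ y n)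
  add-cauchy x y cx cy ε 0<ε
    with cx (½ ℚ.* ε) (half-pos 0<ε) | cy (½ ℚ.* ε) (half-pos 0<ε)
  ... | M , closeˣ | N , closeʸ = M ℕ.⊔ N , close
    where
    close : ∀ m n → M ℕ.⊔ N ℕ.≤ m → M ℕ.⊔ N ℕ.≤ n →
            ∣ (x m ℚ.+ y m) ℚ.- (x n ℚ.+ y n) ∣ ℚ.< ε
    close m n ≤m ≤n = begin-strict
      ∣ (x m ℚ.+ y m) ℚ.- (x n ℚ.+ y n) ∣
        ≡⟨ cong ∣_∣ (add-diff (x m) (y m) (x n) (y n)) ⟩
      ∣ (x m ℚ.- x n) ℚ.+ (y m ℚ.- y n) ∣
        ≤⟨ ℚₚ.∣p+q∣≤∣p∣+∣q∣ (x m ℚ.- x n) (y m ℚ.- y n) ⟩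
      ∣ x m ℚ.- x n ∣ ℚ.+ ∣ y m ℚ.- y n ∣
        <⟨ ℚₚ.+-mono-< (closeˣ m n (ℕₚ.m⊔n≤o⇒m≤o M N ≤m) (ℕₚ.m⊔n≤o⇒m≤o M N ≤n))
                       (closeʸ m n (ℕₚ.m⊔n≤o⇒n≤o M N ≤m) (ℕₚ.m⊔n≤o⇒n≤o M N ≤n)) ⟩
      ½ ℚ.* ε ℚ.+ ½ ℚ.* ε
        ≡⟨ ½+½ ε ⟩
      ε ∎
      where open ℚₚ.≤-Reasoning

  divide : ∀ {ε C} → 0ℚ ℚ.< ε → 0ℚ ℚ.< C → ∃[ δ ] (0ℚ ℚ.< δ × C ℚ.* δ ≡ ε)
  divide {ε} {C} 0<ε 0<C = 1/ C ℚ.* ε , 0<δ , Cδ≡ε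
    where
    instance
      C-pos : ℚ.Positive C
      C-pos = ℚ.positive 0<C
      C-nonZero : ℚ.NonZero C
      C-nonZero = ℚₚ.pos⇒nonZero C

    0<δ : 0ℚ ℚ.< 1/ C ℚ.* ε
    0<δ = subst (ℚ._< 1/ C ℚ.* ε) (ℚₚ.*-zeroʳ (1/ C))
            (ℚₚ.*-monoʳ-<-pos (1/ C) {{ℚₚ.1/pos⇒pos C}} 0<ε)

    Cδ≡ε : C ℚ.* (1/ C ℚ.* ε) ≡ ε
    Cδ≡ε = trans (sym (ℚₚ.*-assoc C (1/ C) ε))
             (trans (cong (ℚ._* ε) (ℚₚ.*-inverseʳ C)) (ℚₚ.*-identityˡ ε))

  product-bound : ∀ p q {B δ} → 0ℚ ℚ.< B →
                  ∣ p ∣ ℚ.< B → ∣ q ∣ ℚ.< δ → ∣ p ℚ.* q ∣ ℚ.< B ℚ.* δ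
  product-bound p q {B} {δ} 0<B p<B q<δ = begin-strict
    ∣ p ℚ.* q ∣       ≡⟨ ℚₚ.∣p*q∣≡∣p∣*∣q∣ p q ⟩
    ∣ p ∣ ℚ.* ∣ q ∣   ≤⟨ ℚₚ.*-monoʳ-≤-nonNeg ∣ q ∣ {{ℚₚ.∣-∣-nonNeg q}} (ℚₚ.<⇒≤ p<B) ⟩
    B ℚ.* ∣ q ∣       <⟨ ℚₚ.*-monoʳ-<-pos B {{ℚ.positive 0<B}} q<δ ⟩
    B ℚ.* δ           ∎
    where open ℚₚ.≤-Reasoning

  sum-pos : ∀ {p q} → 0ℚ ℚ.< p → 0ℚ ℚ.< q → 0ℚ ℚ.< p ℚ.+ q
  sum-pos {p} {q} 0<p 0<q = begin-strict
    0ℚ         <⟨ 0<p ⟩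
    p          ≡⟨ ℚₚ.+-identityʳ p ⟨
    p ℚ.+ 0ℚ   <⟨ ℚₚ.+-monoʳ-< p 0<q ⟩
    p ℚ.+ q    ∎
    where open ℚₚ.≤-Reasoning

  product-diff-bound : ∀ p q r s {A B δ} → 0ℚ ℚ.< A → 0ℚ ℚ.< B →
    ∣ p ∣ ℚ.< A → ∣ s ∣ ℚ.< B → ∣ p ℚ.- r ∣ ℚ.< δ → ∣ q ℚ.- s ∣ ℚ.< δ →
    ∣ p ℚ.* q ℚ.- r ℚ.* s ∣ ℚ.< (A ℚ.+ B) ℚ.* δ
  product-diff-bound p q r s {A} {B} {δ} 0<A 0<B p<A s<B p-r<δ q-s<δ = begin-strict
    ∣ p ℚ.* q ℚ.- r ℚ.* s ∣
      ≡⟨ cong ∣_∣ (mul-diff p q r s) ⟩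
    ∣ p ℚ.* (q ℚ.- s) ℚ.+ s ℚ.* (p ℚ.- r) ∣
      ≤⟨ ℚₚ.∣p+q∣≤∣p∣+∣q∣ (p ℚ.* (q ℚ.- s)) (s ℚ.* (p ℚ.- r)) ⟩
    ∣ p ℚ.* (q ℚ.- s) ∣ ℚ.+ ∣ s ℚ.* (p ℚ.- r) ∣
      <⟨ ℚₚ.+-mono-< (product-bound p (q ℚ.- s) 0<A p<A q-s<δ)
                     (product-bound s (p ℚ.- r) 0<B s<B p-r<δ) ⟩
    A ℚ.* δ ℚ.+ B ℚ.* δ
      ≡⟨ ℚₚ.*-distribʳ-+ δ A B ⟨
    (A ℚ.+ B) ℚ.* δ ∎
    where open ℚₚ.≤-Reasoning

  -- Local functions instead of nested 'with', which is very slow to check here.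
  mul-cauchy : ∀ x y → IsCauchy x → IsCauchy y → IsCauchy (λ n → x n ℚ.* y n)
  mul-cauchy x y cx cy ε 0<ε = combine (bounded x cx) (bounded y cy)
    where
    Goal : Set
    Goal = ∃[ N ] (∀ m n → N ℕ.≤ m → N ℕ.≤ n → ∣ x m ℚ.* y m ℚ.- x n ℚ.* y n ∣ ℚ.< ε)

    combine : EventuallyBounded x → EventuallyBounded y → Goal
    combine (A , 0<A , K , boundˣ) (B , 0<B , L , boundʸ) =
      combine′ (divide 0<ε (sum-pos 0<A 0<B))
      where
      combine′ : ∃[ δ ] (0ℚ ℚ.< δ × (A ℚ.+ B) ℚ.* δ ≡ ε) → Goal
      combine′ (δ , 0<δ , [A+B]δ≡ε) = combine″ (cx δ 0<δ) (cy δ 0<δ)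
        where
        Close : (ℕ → ℚ) → Set
        Close z = ∃[ N ] (∀ m n → N ℕ.≤ m → N ℕ.≤ n → ∣ z m ℚ.- z n ∣ ℚ.< δ)

        combine″ : Close x → Close y → Goal
        combine″ (M , closeˣ) (N , closeʸ) = (K ℕ.⊔ L) ℕ.⊔ (M ℕ.⊔ N) , λ m n ≤m ≤n →
          subst (∣ x m ℚ.* y m ℚ.- x n ℚ.* y n ∣ ℚ.<_) [A+B]δ≡ε
            (product-diff-bound (x m) (y m) (x n) (y n) 0<A 0<B
              (boundˣ m (K≤ ≤m)) (boundʸ n (L≤ ≤n))
              (closeˣ m n (M≤ ≤m) (M≤ ≤n)) (closeʸ m n (N≤ ≤m) (N≤ ≤n)))
          where
          module _ {n} (≤n : (K ℕ.⊔ L) ℕ.⊔ (M ℕ.⊔ N) ℕ.≤ n) where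
            K≤ : K ℕ.≤ n
            K≤ = ℕₚ.m⊔n≤o⇒m≤o K L (ℕₚ.m⊔n≤o⇒m≤o (K ℕ.⊔ L) (M ℕ.⊔ N) ≤n)
            L≤ : L ℕ.≤ n
            L≤ = ℕₚ.m⊔n≤o⇒n≤o K L (ℕₚ.m⊔n≤o⇒m≤o (K ℕ.⊔ L) (M ℕ.⊔ N) ≤n)
            M≤ : M ℕ.≤ n
            M≤ = ℕₚ.m⊔n≤o⇒m≤o M N (ℕₚ.m⊔n≤o⇒n≤o (K ℕ.⊔ L) (M ℕ.⊔ N) ≤n)
            N≤ : N ℕ.≤ n
            N≤ = ℕₚ.m⊔n≤o⇒n≤o M N (ℕₚ.m⊔n≤o⇒n≤o (K ℕ.⊔ L) (M ℕ.⊔ N) ≤n)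

infixl 6 _+_
infixl 7 _*_
infix  8 -_

fromℚ : ℚ → ℝ
fromℚ q = mkℝ (λ _ → q) (const-cauchy q)

0ℝ : ℝ
0ℝ = fromℚ 0ℚ

_+_ : ℝ → ℝ → ℝ
x + y = mkℝ (λ n → seq x n ℚ.+ seq y n) (add-cauchy (seq x) (seq y) (cauchy x) (cauchy y))

_*_ : ℝ → ℝ → ℝ
x * y = mkℝ (λ n → seq x n ℚ.* seq y n) (mul-cauchy (seq x) (seq y) (cauchy x) (cauchy y))

-_ : ℝ → ℝ
- x = mkℝ (λ n → ℚ.- seq x n) (neg-cauchy (seq x) (cauchy x))

------------------------------------------------------------------------
-- Complex numbers

record ℂ : Set where
  constructor _+i_
  field
    re im : ℝ

open ℂ public

infix  4 _≈ᶜ_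
infixl 6 _+ᶜ_
infixl 7 _*ᶜ_

_≈ᶜ_ : ℂ → ℂ → Set
z ≈ᶜ w = re z ≈ re w × im z ≈ im w

fromℝ : ℝ → ℂ
fromℝ x = x +i 0ℝ

0ᶜ : ℂ
0ᶜ = fromℝ 0ℝ

_+ᶜ_ : ℂ → ℂ → ℂ
z +ᶜ w = (re z + re w) +i (im z + im w)

_*ᶜ_ : ℂ → ℂ → ℂ
z *ᶜ w = (re z * re w + - (im z * im w)) +i (re z * im w + im z * re w)

------------------------------------------------------------------------
-- Real square matrices, their complex eigenvalues, stability

Matrix : ℕ → Set
Matrix m = Fin m → Fin m → ℝ

pencil : ∀ {m} → Matrix m → Matrix m → ℝ → Matrix m
pencil F H α i j = F i j + α * H i j

_·_ : ∀ {m} → Matrix m → Vector ℂ m → Vector ℂ m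
(A · v) i = foldr _+ᶜ_ 0ᶜ (λ j → fromℝ (A i j) *ᶜ v j)

IsEigenvalue : ∀ {m} → Matrix m → ℂ → Set
IsEigenvalue {m} A μ = ∃[ v ]
  (¬ (∀ (i : Fin m) → v i ≈ᶜ 0ᶜ)) × (∀ i → (A · v) i ≈ᶜ μ *ᶜ v i)

Stable : ∀ {m} → Matrix m → Set
Stable A = ∀ μ → IsEigenvalue A μ → re μ < 0ℝ

StabilityRegion : ∀ {m} → Matrix m → Matrix m → Pred ℝ 0ℓ
StabilityRegion F H α = α < 0ℝ × Stable (pencil F H α)

------------------------------------------------------------------------
-- Connected components of a set of reals: its nonempty maximal intervals

-- Order-convexity.  Since x ≈ y implies x ≤ y and y ≤ x, every such set
-- is automatically closed under _≈_.
IsInterval : Pred ℝ 0ℓ → Set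
IsInterval I = ∀ x y z → x ∈ I → z ∈ I → x ≤ y → y ≤ z → y ∈ I

record IsComponent (S C : Pred ℝ 0ℓ) : Set₁ where
  field
    nonempty : Satisfiable C
    interval : IsInterval C
    subset   : C ⊆ S
    maximal  : ∀ (T : Pred ℝ 0ℓ) → IsInterval T → T ⊆ S → C ⊆ T → T ⊆ C

-- S has exactly k connected components.
record HasComponents (S : Pred ℝ 0ℓ) (k : ℕ) : Set₁ where
  field
    component   : Fin k → Pred ℝ 0ℓ
    isComponent : ∀ i → IsComponent S (component i)
    disjoint    : ∀ i j → i ≢ j → ∀ x → x ∈ component i → x ∈ component j → ⊥
    covers      : ∀ x → x ∈ S → ∃[ i ] x ∈ component i

HasDisconnectedStableRegions : ∀ {m} → Matrix m → Matrix m → ℕ → Set₁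
HasDisconnectedStableRegions F H k = HasComponents (StabilityRegion F H) k

{-# OPTIONS --safe #-}
module Submission where

open import Defs
open import Data.Bool.Base using (if_then_else_)
open import Data.Empty using (⊥; ⊥-elim)
open import Data.Fin.Base using (Fin; zero; suc; toℕ; fromℕ<; combine; remQuot; _↑ˡ_; _↑ʳ_)
import Data.Fin.Properties as Finₚ
open import Data.Integer.Base as ℤ using (+_; -[1+_])
open import Data.Nat.Base as ℕ using (ℕ; zero; suc)
import Data.Nat.Properties as ℕₚ
open import Data.Product using (_×_; _,_; ∃-syntax; Σ-syntax; proj₁; proj₂)
open import Data.Rational.Base as ℚ using (ℚ; 0ℚ; 1ℚ; ½; ∣_∣; 1/_; mkℚ)
import Data.Rational.Properties as ℚₚ
open import Data.Rational.Solver using (module +-*-Solver)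
open import Data.Rational.Unnormalised.Base as ℚᵘ using (mkℚᵘ)
import Data.Rational.Unnormalised.Properties as ℚᵘₚ
open import Data.Sum.Base using (_⊎_; inj₁; inj₂; [_,_]′)
open import Data.Vec.Functional using (Vector; foldr)
open import Function.Base using (_∘_; id)
open import Level using (0ℓ)
open import Relation.Binary.Definitions using (tri<; tri≈; tri>)
open import Relation.Binary.PropositionalEquality
  using (_≡_; _≢_; refl; sym; trans; cong; cong₂; subst; subst₂)
open import Relation.Nullary using (¬_; Dec; yes; no; does)
open import Relation.Nullary.Decidable using (dec-true; dec-false)
open import Relation.Unary using (Pred; _∈_; _⊆_)

-- Take n - 1 diagonal blocks ((0 , β) , (-β , -2)) with β = α + k, 1 ≤ k ≤ n - 1.
-- A block has characteristic polynomial μ² + 2μ + β², whose roots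
-- -1 ± √(1 - β²) have negative real part unless β = 0, so the stability region
-- is the negative half line with the points -1, …, -(n - 1) removed.
--
-- Constructively, a point of the region has to be located relative to every -k,
-- so stability must yield β apart from 0.  For |β| < ½ the root -r with
-- r = (r² + β²) / 2 is built by fixed point iteration; stability gives r > 0,
-- hence β² = r (2 - r) > 0.

-- The sign of a real cannot be decided, and the nonvanishing of an eigenvector is only a negated
-- universal statement. Case splits on reals therefore run through cotransitivity: a positive sum
-- has a positive summand. In one direction this yields, block by block, either Re μ < 0 or the
-- vanishing of both coordinates. In the other it leaves only the strip |β| < ½ to an eigenvalue,
-- because elsewhere a sign of β is already known. The bound ½ gives β² ≤ ¼, small enough for an
-- iteration on rationals without square roots or division by reals. The skew position of β makes
-- the characteristic polynomial depend on β² alone, so both signs of β are stable and each block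
-- removes a single value of α.

open +-*-Solver using (solve; _:=_; _:+_; _:*_; _:-_; :-_; con)

-- Rational inequalities through signs of differences

0<1 : 0ℚ ℚ.< 1ℚ
0<1 = ℚₚ.positive⁻¹ 1ℚ

0<½ : 0ℚ ℚ.< ½
0<½ = ℚₚ.positive⁻¹ ½

<⇒0<- : ∀ {p q} → p ℚ.< q → 0ℚ ℚ.< q ℚ.- p
<⇒0<- {p} {q} p<q = subst (ℚ._< q ℚ.- p) (ℚₚ.+-inverseʳ p) (ℚₚ.+-monoˡ-< (ℚ.- p) p<q)

0<-⇒< : ∀ {p q} → 0ℚ ℚ.< q ℚ.- p → p ℚ.< q
0<-⇒< {p} {q} h = subst₂ ℚ._<_ (ℚₚ.+-identityʳ p) (eq p q) (ℚₚ.+-monoʳ-< p h)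
  where
  eq : ∀ p q → p ℚ.+ (q ℚ.- p) ≡ q
  eq = solve 2 (λ p q → p :+ (q :- p) := q) refl

≤⇒0≤- : ∀ {p q} → p ℚ.≤ q → 0ℚ ℚ.≤ q ℚ.- p
≤⇒0≤- {p} {q} p≤q = subst (ℚ._≤ q ℚ.- p) (ℚₚ.+-inverseʳ p) (ℚₚ.+-monoˡ-≤ (ℚ.- p) p≤q)

0≤-⇒≤ : ∀ {p q} → 0ℚ ℚ.≤ q ℚ.- p → p ℚ.≤ q
0≤-⇒≤ {p} {q} h = subst₂ ℚ._≤_ (ℚₚ.+-identityʳ p) (eq p q) (ℚₚ.+-monoʳ-≤ p h)
  where
  eq : ∀ p q → p ℚ.+ (q ℚ.- p) ≡ q
  eq = solve 2 (λ p q → p :+ (q :- p) := q) refl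

0<+ : ∀ {p q} → 0ℚ ℚ.< p → 0ℚ ℚ.< q → 0ℚ ℚ.< p ℚ.+ q
0<+ 0<p 0<q = ℚₚ.+-mono-< 0<p 0<q

0<+≤ : ∀ {p q} → 0ℚ ℚ.< p → 0ℚ ℚ.≤ q → 0ℚ ℚ.< p ℚ.+ q
0<+≤ 0<p 0≤q = ℚₚ.+-mono-<-≤ 0<p 0≤q

0<* : ∀ {p q} → 0ℚ ℚ.< p → 0ℚ ℚ.< q → 0ℚ ℚ.< p ℚ.* q
0<* {p} {q} 0<p 0<q =
  subst (ℚ._< p ℚ.* q) (ℚₚ.*-zeroʳ p) (ℚₚ.*-monoʳ-<-pos p {{ℚ.positive 0<p}} 0<q)

0≤* : ∀ {p q} → 0ℚ ℚ.≤ p → 0ℚ ℚ.≤ q → 0ℚ ℚ.≤ p ℚ.* q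
0≤* {p} {q} 0≤p 0≤q =
  subst (ℚ._≤ p ℚ.* q) (ℚₚ.*-zeroʳ p) (ℚₚ.*-monoˡ-≤-nonNeg p {{ℚ.nonNegative 0≤p}} 0≤q)

neg-nonNeg : ∀ {p} → p ℚ.≤ 0ℚ → 0ℚ ℚ.≤ ℚ.- p
neg-nonNeg = ℚₚ.neg-antimono-≤

0≤square : ∀ p → 0ℚ ℚ.≤ p ℚ.* p
0≤square p with ℚₚ.≤-total 0ℚ p
... | inj₁ 0≤p = 0≤* 0≤p 0≤p
... | inj₂ p≤0 = subst (0ℚ ℚ.≤_) (eq p) (0≤* (neg-nonNeg p≤0) (neg-nonNeg p≤0))
  where
  eq : ∀ p → (ℚ.- p) ℚ.* (ℚ.- p) ≡ p ℚ.* p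
  eq = solve 1 (λ p → (:- p) :* (:- p) := p :* p) refl

≤∣∣ : ∀ p → p ℚ.≤ ∣ p ∣
≤∣∣ p with ℚₚ.≤-total 0ℚ p
... | inj₁ 0≤p = ℚₚ.≤-reflexive (sym (ℚₚ.0≤p⇒∣p∣≡p 0≤p))
... | inj₂ p≤0 = ℚₚ.≤-trans p≤0 (ℚₚ.0≤∣p∣ p)

∣∣<⇒< : ∀ {p ε} → ∣ p ∣ ℚ.< ε → p ℚ.< ε
∣∣<⇒< {p} = ℚₚ.≤-<-trans (≤∣∣ p)

∣∣<-intro : ∀ {p ε} → p ℚ.< ε → ℚ.- p ℚ.< ε → ∣ p ∣ ℚ.< ε
∣∣<-intro {p} h₁ h₂ with ℚₚ.∣p∣≡p∨∣p∣≡-p p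
... | inj₁ eq = subst (ℚ._< _) (sym eq) h₁
... | inj₂ eq = subst (ℚ._< _) (sym eq) h₂

∣∣≤-intro : ∀ {p ε} → p ℚ.≤ ε → ℚ.- p ℚ.≤ ε → ∣ p ∣ ℚ.≤ ε
∣∣≤-intro {p} h₁ h₂ with ℚₚ.∣p∣≡p∨∣p∣≡-p p
... | inj₁ eq = subst (ℚ._≤ _) (sym eq) h₁
... | inj₂ eq = subst (ℚ._≤ _) (sym eq) h₂

½+½≡ : ∀ p → ½ ℚ.* p ℚ.+ ½ ℚ.* p ≡ p
½+½≡ = solve 1 (λ p → con ½ :* p :+ con ½ :* p := p) refl

0<½* : ∀ {p} → 0ℚ ℚ.< p → 0ℚ ℚ.< ½ ℚ.* p
0<½* = 0<* 0<½

-- Eventual properties and equality of Cauchy reals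

eventually-map₂ : ∀ {P Q R : Pred ℕ 0ℓ} → (∀ n → P n → Q n → R n) →
                  Eventually P → Eventually Q → Eventually R
eventually-map₂ f (M , p) (N , q) = M ℕ.⊔ N , λ n ≤n →
  f n (p n (ℕₚ.m⊔n≤o⇒m≤o M N ≤n)) (q n (ℕₚ.m⊔n≤o⇒n≤o M N ≤n))

eventually-map : ∀ {P Q : Pred ℕ 0ℓ} → (∀ n → P n → Q n) → Eventually P → Eventually Q
eventually-map f (N , p) = N , λ n ≤n → f n (p n ≤n)

≈-pointwise : ∀ {x y} → (∀ n → seq x n ≡ seq y n) → x ≈ y
≈-pointwise {x} {y} x≡y ε 0<ε = 0 , λ n _ →
  subst (ℚ._< ε) (sym (cong ∣_∣ (trans (cong (ℚ._- seq y n) (x≡y n)) (ℚₚ.+-inverseʳ (seq y n))))) 0<ε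

≈-refl : ∀ {x} → x ≈ x
≈-refl {x} = ≈-pointwise {x} {x} λ _ → refl

≈-sym : ∀ {x y} → x ≈ y → y ≈ x
≈-sym {x} {y} x≈y ε 0<ε =
  eventually-map (λ n → subst (ℚ._< ε) (trans (sym (ℚₚ.∣-p∣≡∣p∣ (seq x n ℚ.- seq y n)))
    (cong ∣_∣ (eq (seq x n) (seq y n))))) (x≈y ε 0<ε)
  where
  eq : ∀ p q → ℚ.- (p ℚ.- q) ≡ q ℚ.- p
  eq = solve 2 (λ p q → :- (p :- q) := q :- p) refl

+-close : ∀ p q {ε} → ∣ p ∣ ℚ.< ½ ℚ.* ε → ∣ q ∣ ℚ.< ½ ℚ.* ε → ∣ p ℚ.+ q ∣ ℚ.< ε
+-close p q {ε} p<ε q<ε = ℚₚ.≤-<-trans (ℚₚ.∣p+q∣≤∣p∣+∣q∣ p q)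
  (subst (∣ p ∣ ℚ.+ ∣ q ∣ ℚ.<_) (½+½≡ ε) (ℚₚ.+-mono-< p<ε q<ε))

≈-trans : ∀ {x y z} → x ≈ y → y ≈ z → x ≈ z
≈-trans {x} {y} {z} x≈y y≈z ε 0<ε = eventually-map₂
  (λ n h k → subst (λ d → ∣ d ∣ ℚ.< ε) (eq (seq x n) (seq y n) (seq z n)) (+-close _ _ h k))
  (x≈y (½ ℚ.* ε) (0<½* 0<ε)) (y≈z (½ ℚ.* ε) (0<½* 0<ε))
  where
  eq : ∀ p q r → (p ℚ.- q) ℚ.+ (q ℚ.- r) ≡ p ℚ.- r
  eq = solve 3 (λ p q r → (p :- q) :+ (q :- r) := p :- r) refl

+-cong : ∀ {x x′ y y′} → x ≈ x′ → y ≈ y′ → x + y ≈ x′ + y′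
+-cong {x} {x′} {y} {y′} x≈x′ y≈y′ ε 0<ε = eventually-map₂
  (λ n h k → subst (λ d → ∣ d ∣ ℚ.< ε) (eq (seq x n) (seq x′ n) (seq y n) (seq y′ n)) (+-close _ _ h k))
  (x≈x′ (½ ℚ.* ε) (0<½* 0<ε)) (y≈y′ (½ ℚ.* ε) (0<½* 0<ε))
  where
  eq : ∀ p p′ q q′ → (p ℚ.- p′) ℚ.+ (q ℚ.- q′) ≡ (p ℚ.+ q) ℚ.- (p′ ℚ.+ q′)
  eq = solve 4 (λ p p′ q q′ → (p :- p′) :+ (q :- q′) := (p :+ q) :- (p′ :+ q′)) refl

≈⇒-≈0 : ∀ {x y} → x ≈ y → x + - y ≈ 0ℝ
≈⇒-≈0 {x} {y} x≈y ε 0<ε =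
  eventually-map (λ n → subst (λ d → ∣ d ∣ ℚ.< ε) (sym (ℚₚ.+-identityʳ _))) (x≈y ε 0<ε)

-≈0⇒≈ : ∀ {x y} → x + - y ≈ 0ℝ → x ≈ y
-≈0⇒≈ {x} {y} x-y≈0 ε 0<ε =
  eventually-map (λ n → subst (λ d → ∣ d ∣ ℚ.< ε) (ℚₚ.+-identityʳ _)) (x-y≈0 ε 0<ε)

bounded : ∀ x → ∃[ B ] (0ℚ ℚ.< B × Eventually λ n → ∣ seq x n ∣ ℚ.< B)
bounded x with cauchy x 1ℚ 0<1
... | N , close = 1ℚ ℚ.+ ∣ seq x N ∣ , 0<+≤ 0<1 (ℚₚ.0≤∣p∣ (seq x N)) , N , λ n N≤n →
  subst (λ q → ∣ q ∣ ℚ.< 1ℚ ℚ.+ ∣ seq x N ∣) (eq (seq x n) (seq x N))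
    (ℚₚ.≤-<-trans (ℚₚ.∣p+q∣≤∣p∣+∣q∣ (seq x n ℚ.- seq x N) (seq x N))
      (ℚₚ.+-monoˡ-< ∣ seq x N ∣ (close n N N≤n ℕₚ.≤-refl)))
  where
  eq : ∀ p q → (p ℚ.- q) ℚ.+ q ≡ p
  eq = solve 2 (λ p q → (p :- q) :+ q := p) refl

divide : ∀ {ε B} → 0ℚ ℚ.< ε → 0ℚ ℚ.< B → ∃[ δ ] (0ℚ ℚ.< δ × B ℚ.* δ ≡ ε)
divide {ε} {B} 0<ε 0<B = 1/ B ℚ.* ε , 0<* (ℚₚ.positive⁻¹ (1/ B) {{ℚₚ.1/pos⇒pos B}}) 0<ε ,
  trans (sym (ℚₚ.*-assoc B (1/ B) ε))
    (trans (cong (ℚ._* ε) (ℚₚ.*-inverseʳ B)) (ℚₚ.*-identityˡ ε))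
  where
  instance
    B-pos : ℚ.Positive B
    B-pos = ℚ.positive 0<B
    B-nonZero : ℚ.NonZero B
    B-nonZero = ℚₚ.pos⇒nonZero B

*-small : ∀ p q {B δ} → 0ℚ ℚ.< B → ∣ p ∣ ℚ.< B → ∣ q ℚ.- 0ℚ ∣ ℚ.< δ → ∣ p ℚ.* q ℚ.- 0ℚ ∣ ℚ.< B ℚ.* δ
*-small p q {B} {δ} 0<B p<B q<δ = begin-strict
  ∣ p ℚ.* q ℚ.- 0ℚ ∣   ≡⟨ cong ∣_∣ (ℚₚ.+-identityʳ (p ℚ.* q)) ⟩
  ∣ p ℚ.* q ∣          ≡⟨ ℚₚ.∣p*q∣≡∣p∣*∣q∣ p q ⟩
  ∣ p ∣ ℚ.* ∣ q ∣      ≤⟨ ℚₚ.*-monoʳ-≤-nonNeg ∣ q ∣ {{ℚₚ.∣-∣-nonNeg q}} (ℚₚ.<⇒≤ p<B) ⟩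
  B ℚ.* ∣ q ∣          <⟨ ℚₚ.*-monoʳ-<-pos B {{ℚ.positive 0<B}} (subst (λ d → ∣ d ∣ ℚ.< δ) (ℚₚ.+-identityʳ q) q<δ) ⟩
  B ℚ.* δ              ∎
  where open ℚₚ.≤-Reasoning

-- Cauchy sequences are eventually bounded, so null sequences absorb them. This takes the place of
-- congruence of `_*_`: later equations are written as combinations of null reals with arbitrary
-- coefficients, and `≈0-resp` reduces the rest to a rational ring identity at each index.
*-zeroʳ-≈ : ∀ x {y} → y ≈ 0ℝ → x * y ≈ 0ℝ
*-zeroʳ-≈ x {y} y≈0 ε 0<ε = bound (bounded x)
  where
  Goal : Set
  Goal = Eventually λ n → ∣ seq x n ℚ.* seq y n ℚ.- 0ℚ ∣ ℚ.< ε

  bound : ∃[ B ] (0ℚ ℚ.< B × Eventually λ n → ∣ seq x n ∣ ℚ.< B) → Goal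
  bound (B , 0<B , x<B) = scale (divide 0<ε 0<B)
    where
    scale : ∃[ δ ] (0ℚ ℚ.< δ × B ℚ.* δ ≡ ε) → Goal
    scale (δ , 0<δ , Bδ≡ε) = eventually-map₂
      (λ n h k → subst (∣ seq x n ℚ.* seq y n ℚ.- 0ℚ ∣ ℚ.<_) Bδ≡ε (*-small (seq x n) (seq y n) 0<B h k))
      x<B (y≈0 δ 0<δ)

≈0-+ : ∀ {x y} → x ≈ 0ℝ → y ≈ 0ℝ → x + y ≈ 0ℝ
≈0-+ {x} {y} x≈0 y≈0 = ≈-trans {x + y} {0ℝ + 0ℝ} {0ℝ} (+-cong {x} {0ℝ} {y} {0ℝ} x≈0 y≈0) (≈-pointwise {0ℝ + 0ℝ} {0ℝ} λ _ → refl)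

≈0-resp : ∀ {x y} → (∀ n → seq x n ≡ seq y n) → x ≈ 0ℝ → y ≈ 0ℝ
≈0-resp {x} {y} x≡y x≈0 = ≈-trans {y} {x} {0ℝ} (≈-pointwise {y} {x} λ n → sym (x≡y n)) x≈0

-- Positivity with an explicit rational margin, and apartness from zero

Pos : ℝ → Set
Pos x = ∃[ ε ] (0ℚ ℚ.< ε × Eventually λ n → ε ℚ.< seq x n)

<⇒Pos : ∀ {x y} → x < y → Pos (y + - x)
<⇒Pos {x} {y} (ε , 0<ε , ev) = ε , 0<ε ,
  eventually-map (λ n h → 0<-⇒< (subst (0ℚ ℚ.<_) (eq (seq x n) (seq y n) ε) (<⇒0<- h))) ev
  where
  eq : ∀ p q e → q ℚ.- (p ℚ.+ e) ≡ (q ℚ.- p) ℚ.- e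
  eq = solve 3 (λ p q e → q :- (p :+ e) := (q :- p) :- e) refl

Pos⇒< : ∀ {x y} → Pos (y + - x) → x < y
Pos⇒< {x} {y} (ε , 0<ε , ev) = ε , 0<ε ,
  eventually-map (λ n h → 0<-⇒< (subst (0ℚ ℚ.<_) (eq (seq x n) (seq y n) ε) (<⇒0<- h))) ev
  where
  eq : ∀ p q e → (q ℚ.- p) ℚ.- e ≡ q ℚ.- (p ℚ.+ e)
  eq = solve 3 (λ p q e → (q :- p) :- e := q :- (p :+ e)) refl

Pos-resp : ∀ {x y} → (∀ n → seq x n ≡ seq y n) → Pos x → Pos y
Pos-resp x≡y (ε , 0<ε , ev) = ε , 0<ε , eventually-map (λ n → subst (ε ℚ.<_) (x≡y n)) ev

Pos-const : ∀ {q} → 0ℚ ℚ.< q → Pos (fromℚ q)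
Pos-const {q} 0<q = ½ ℚ.* q , 0<½* 0<q , 0 , λ _ _ →
  0<-⇒< (subst (0ℚ ℚ.<_) (eq q) (0<½* 0<q))
  where
  eq : ∀ q → ½ ℚ.* q ≡ q ℚ.- ½ ℚ.* q
  eq = solve 1 (λ q → con ½ :* q := q :- con ½ :* q) refl

-- Asking nonnegativity of every term keeps the margin unchanged, and squares and nonnegative
-- constants satisfy it term by term.
Pos-+-nonNeg : ∀ {x y} → Pos x → (∀ n → 0ℚ ℚ.≤ seq y n) → Pos (x + y)
Pos-+-nonNeg {x} {y} (ε , 0<ε , ev) 0≤y = ε , 0<ε , eventually-map
  (λ n h → subst (ℚ._< seq x n ℚ.+ seq y n) (ℚₚ.+-identityʳ ε) (ℚₚ.+-mono-<-≤ h (0≤y n))) ev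

Pos-+ : ∀ {x y} → Pos x → Pos y → Pos (x + y)
Pos-+ (ε , 0<ε , ev) (δ , 0<δ , ev′) = ε ℚ.+ δ , 0<+ 0<ε 0<δ ,
  eventually-map₂ (λ _ → ℚₚ.+-mono-<) ev ev′

Pos-* : ∀ {x y} → Pos x → Pos y → Pos (x * y)
Pos-* {x} {y} (ε , 0<ε , ev) (δ , 0<δ , ev′) = ε ℚ.* δ , 0<* 0<ε 0<δ , eventually-map₂
  (λ n h k → ℚₚ.<-trans
    (ℚₚ.*-monoˡ-<-pos δ {{ℚ.positive 0<δ}} h)
    (ℚₚ.*-monoʳ-<-pos (seq x n) {{ℚ.positive (ℚₚ.<-trans 0<ε h)}} k)) ev ev′

¬Pos-0 : ¬ Pos 0ℝ
¬Pos-0 (ε , 0<ε , N , ev) = ℚₚ.<-asym 0<ε (ev N ℕₚ.≤-refl)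

Pos-resp-≈ : ∀ {x y} → x ≈ y → Pos x → Pos y
Pos-resp-≈ {x} {y} x≈y (ε , 0<ε , ev) = ½ ℚ.* ε , 0<½* 0<ε , eventually-map₂
  (λ n h k → 0<-⇒< (subst (0ℚ ℚ.<_) (eq (seq x n) (seq y n) ε)
     (0<+ (<⇒0<- h) (<⇒0<- (∣∣<⇒< k))))) ev (x≈y (½ ℚ.* ε) (0<½* 0<ε))
  where
  eq : ∀ p q e → (p ℚ.- e) ℚ.+ (½ ℚ.* e ℚ.- (p ℚ.- q)) ≡ q ℚ.- ½ ℚ.* e
  eq = solve 3 (λ p q e → (p :- e) :+ (con ½ :* e :- (p :- q)) := q :- con ½ :* e) refl

-- The Cauchy modulus locates x relative to ε/2, which decides the alternative.
Pos-cotrans : ∀ {x y} → Pos (x + y) → Pos x ⊎ Pos y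
Pos-cotrans {x} {y} (ε , 0<ε , ev) = decide (cauchy x δ 0<δ)
  where
  δ : ℚ
  δ = ½ ℚ.* (½ ℚ.* ε)

  0<δ : 0ℚ ℚ.< δ
  0<δ = 0<½* (0<½* 0<ε)

  above : ∀ p q e → (p ℚ.- ½ ℚ.* e) ℚ.+ (½ ℚ.* (½ ℚ.* e) ℚ.- (p ℚ.- q)) ≡ q ℚ.- ½ ℚ.* (½ ℚ.* e)
  above = solve 3 (λ p q e → (p :- con ½ :* e) :+ (con ½ :* (con ½ :* e) :- (p :- q))
                      := q :- con ½ :* (con ½ :* e)) refl

  below : ∀ p q r e → ((q ℚ.+ r ℚ.- e) ℚ.+ (½ ℚ.* (½ ℚ.* e) ℚ.- (q ℚ.- p))) ℚ.+ (½ ℚ.* e ℚ.- p)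
            ≡ r ℚ.- ½ ℚ.* (½ ℚ.* e)
  below = solve 4 (λ p q r e → ((q :+ r :- e) :+ (con ½ :* (con ½ :* e) :- (q :- p))) :+ (con ½ :* e :- p)
            := r :- con ½ :* (con ½ :* e)) refl

  decide : ∃[ N ] (∀ m n → N ℕ.≤ m → N ℕ.≤ n → ∣ seq x m ℚ.- seq x n ∣ ℚ.< δ) → Pos x ⊎ Pos y
  decide (N , close) with ½ ℚ.* ε ℚₚ.<? seq x N
  ... | yes h = inj₁ (δ , 0<δ , N , λ n N≤n →
    0<-⇒< (subst (0ℚ ℚ.<_) (above (seq x N) (seq x n) ε)
      (0<+ (<⇒0<- h) (<⇒0<- (∣∣<⇒< (close N n ℕₚ.≤-refl N≤n))))))
  ... | no ¬h = inj₂ (δ , 0<δ , eventually-map₂ (λ n k l →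
    0<-⇒< (subst (0ℚ ℚ.<_) (below (seq x N) (seq x n) (seq y n) ε)
      (0<+≤ (0<+ (<⇒0<- k) (<⇒0<- (∣∣<⇒< l))) (≤⇒0≤- (ℚₚ.≮⇒≥ ¬h)))))
    ev (N , λ n N≤n → close n N N≤n ℕₚ.≤-refl))

-- Tightness of apartness. A single term of size at least ε beyond the modulus for ε/2 would keep
-- all later terms on its side of 0 with margin ε/2; since rationals compare decidably, refuting
-- this bounds the term.
¬Pos⇒≈0 : ∀ {x} → ¬ Pos x → ¬ Pos (- x) → x ≈ 0ℝ
¬Pos⇒≈0 {x} ¬x>0 ¬x<0 ε 0<ε with cauchy x (½ ℚ.* ε) (0<½* 0<ε)
... | N , close = N , λ n N≤n → ∣∣<-intro (upper n N≤n) (lower n N≤n)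
  where
  δ : ℚ
  δ = ½ ℚ.* ε

  0<δ : 0ℚ ℚ.< δ
  0<δ = 0<½* 0<ε

  eq₁ : ∀ p q e → (p ℚ.- 0ℚ ℚ.- e) ℚ.+ (½ ℚ.* e ℚ.- (p ℚ.- q)) ≡ q ℚ.- ½ ℚ.* e
  eq₁ = solve 3 (λ p q e → (p :- con 0ℚ :- e) :+ (con ½ :* e :- (p :- q)) := q :- con ½ :* e) refl

  eq₂ : ∀ p q e → (ℚ.- (p ℚ.- 0ℚ) ℚ.- e) ℚ.+ (½ ℚ.* e ℚ.- (q ℚ.- p)) ≡ ℚ.- q ℚ.- ½ ℚ.* e
  eq₂ = solve 3 (λ p q e → (:- (p :- con 0ℚ) :- e) :+ (con ½ :* e :- (q :- p)) := :- q :- con ½ :* e) refl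

  upper : ∀ n → N ℕ.≤ n → seq x n ℚ.- 0ℚ ℚ.< ε
  upper n N≤n = ℚₚ.≰⇒> λ ε≤x → ¬x>0 (δ , 0<δ , N , λ m N≤m →
    0<-⇒< (subst (0ℚ ℚ.<_) (trans (ℚₚ.+-comm (δ ℚ.- (seq x n ℚ.- seq x m)) _) (eq₁ (seq x n) (seq x m) ε))
      (0<+≤ (<⇒0<- (∣∣<⇒< (close n m N≤n N≤m))) (≤⇒0≤- ε≤x))))

  lower : ∀ n → N ℕ.≤ n → ℚ.- (seq x n ℚ.- 0ℚ) ℚ.< ε
  lower n N≤n = ℚₚ.≰⇒> λ ε≤-x → ¬x<0 (δ , 0<δ , N , λ m N≤m →
    0<-⇒< (subst (0ℚ ℚ.<_) (trans (ℚₚ.+-comm (δ ℚ.- (seq x m ℚ.- seq x n)) _) (eq₂ (seq x n) (seq x m) ε))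
      (0<+≤ (<⇒0<- (∣∣<⇒< (close m n N≤m N≤n))) (≤⇒0≤- ε≤-x))))

-- Cancels a positive factor without forming its inverse: either sign of `y` would make the product
-- apart from 0, and tightness does the rest.
*≈0⇒≈0 : ∀ {x y} → Pos x → x * y ≈ 0ℝ → y ≈ 0ℝ
*≈0⇒≈0 {x} {y} x>0 xy≈0 = ¬Pos⇒≈0 {y}
  (λ y>0 → ¬Pos-0 (Pos-resp-≈ {x * y} {0ℝ} xy≈0 (Pos-* {x} {y} x>0 y>0)))
  (λ y<0 → ¬Pos-0 (Pos-resp-≈ { - (x * y)} {0ℝ} -xy≈0
     (Pos-resp {x * - y} { - (x * y)} (λ n → sym (ℚₚ.neg-distribʳ-* (seq x n) (seq y n))) (Pos-* {x} { - y} x>0 y<0))))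
  where
  -xy≈0 : - (x * y) ≈ 0ℝ
  -xy≈0 = ≈0-resp {fromℚ (ℚ.- 1ℚ) * (x * y)} { - (x * y)}
    (λ n → eq (seq x n ℚ.* seq y n)) (*-zeroʳ-≈ (fromℚ (ℚ.- 1ℚ)) {x * y} xy≈0)
    where
    eq : ∀ p → ℚ.- 1ℚ ℚ.* p ≡ ℚ.- p
    eq = solve 1 (λ p → con (ℚ.- 1ℚ) :* p := :- p) refl

-- Otherwise p² ≤ p ≤ δ ≤ ε, since p ≤ δ ≤ 1. This spares taking a square root of ε.
large : ∀ {p δ ε} → δ ℚ.≤ ε → δ ℚ.≤ 1ℚ → 0ℚ ℚ.≤ p → ε ℚ.< p ℚ.* p → δ ℚ.< p
large {p} {δ} {ε} δ≤ε δ≤1 0≤p ε<p² = ℚₚ.≰⇒> λ p≤δ → ℚₚ.<-irrefl refl (ℚₚ.<-≤-trans ε<p² (begin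
  p ℚ.* p   ≤⟨ ℚₚ.*-monoʳ-≤-nonNeg p {{ℚ.nonNegative 0≤p}} (ℚₚ.≤-trans p≤δ δ≤1) ⟩
  1ℚ ℚ.* p  ≡⟨ ℚₚ.*-identityˡ p ⟩
  p         ≤⟨ p≤δ ⟩
  δ         ≤⟨ δ≤ε ⟩
  ε         ∎))
  where open ℚₚ.≤-Reasoning

-- The sign is read off one rational term `seq x K`: its absolute value exceeds δ = min(ε, 1), and
-- later terms move by less than δ/2, so the sign persists.
Pos-square⇒apart : ∀ {x} → Pos (x * x) → Pos x ⊎ Pos (- x)
Pos-square⇒apart {x} (ε , 0<ε , M , ev) = decide (cauchy x (½ ℚ.* δ) (0<½* 0<δ))
  where
  δ : ℚ
  δ = ε ℚ.⊓ 1ℚ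

  0<δ : 0ℚ ℚ.< δ
  0<δ with ℚₚ.⊓-sel ε 1ℚ
  ... | inj₁ eq = subst (0ℚ ℚ.<_) (sym eq) 0<ε
  ... | inj₂ eq = subst (0ℚ ℚ.<_) (sym eq) 0<1

  square-neg : ∀ p → p ℚ.* p ≡ (ℚ.- p) ℚ.* (ℚ.- p)
  square-neg = solve 1 (λ p → p :* p := (:- p) :* (:- p)) refl

  eq₁ : ∀ p q e → (p ℚ.- e) ℚ.+ (½ ℚ.* e ℚ.- (p ℚ.- q)) ≡ q ℚ.- ½ ℚ.* e
  eq₁ = solve 3 (λ p q e → (p :- e) :+ (con ½ :* e :- (p :- q)) := q :- con ½ :* e) refl

  eq₂ : ∀ p q e → (ℚ.- p ℚ.- e) ℚ.+ (½ ℚ.* e ℚ.- (q ℚ.- p)) ≡ ℚ.- q ℚ.- ½ ℚ.* e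
  eq₂ = solve 3 (λ p q e → (:- p :- e) :+ (con ½ :* e :- (q :- p)) := :- q :- con ½ :* e) refl

  decide : ∃[ N ] (∀ m n → N ℕ.≤ m → N ℕ.≤ n → ∣ seq x m ℚ.- seq x n ∣ ℚ.< ½ ℚ.* δ) → Pos x ⊎ Pos (- x)
  decide (N , close) = cases (ℚₚ.≤-total 0ℚ (seq x K))
    where
    K : ℕ
    K = M ℕ.⊔ N
    N≤K : N ℕ.≤ K
    N≤K = ℕₚ.m≤n⊔m M N
    x²>ε : ε ℚ.< seq x K ℚ.* seq x K
    x²>ε = ev K (ℕₚ.m≤m⊔n M N)

    cases : 0ℚ ℚ.≤ seq x K ⊎ seq x K ℚ.≤ 0ℚ → Pos x ⊎ Pos (- x)
    cases (inj₁ 0≤x) = inj₁ (½ ℚ.* δ , 0<½* 0<δ , N , λ n N≤n →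
      0<-⇒< (subst (0ℚ ℚ.<_) (eq₁ (seq x K) (seq x n) δ)
        (0<+ (<⇒0<- (large (ℚₚ.p⊓q≤p ε 1ℚ) (ℚₚ.p⊓q≤q ε 1ℚ) 0≤x x²>ε))
             (<⇒0<- (∣∣<⇒< (close K n N≤K N≤n))))))
    cases (inj₂ x≤0) = inj₂ (½ ℚ.* δ , 0<½* 0<δ , N , λ n N≤n →
      0<-⇒< (subst (0ℚ ℚ.<_) (eq₂ (seq x K) (seq x n) δ)
        (0<+ (<⇒0<- (large (ℚₚ.p⊓q≤p ε 1ℚ) (ℚₚ.p⊓q≤q ε 1ℚ) (neg-nonNeg x≤0)
                (subst (ε ℚ.<_) (square-neg (seq x K)) x²>ε)))
             (<⇒0<- (∣∣<⇒< (close n K N≤n N≤K))))))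

-- Geometric decay and a fixed point by iteration

½^_ : ℕ → ℚ
½^ zero  = 1ℚ
½^ suc n = ½ ℚ.* ½^ n

-- Induction from n + 2 ≤ 2 (n + 1). Unnormalised fractions turn this into an inequality of
-- naturals, free of common divisors.
½^n≤1/[1+n] : ∀ n → ℚ.toℚᵘ (½^ n) ℚᵘ.≤ mkℚᵘ (+ 1) n
½^n≤1/[1+n] zero    = ℚᵘₚ.≤-refl
½^n≤1/[1+n] (suc n) = begin
  ℚ.toℚᵘ (½ ℚ.* ½^ n)          ≃⟨ ℚₚ.toℚᵘ-homo-* ½ (½^ n) ⟩
  ℚᵘ.½ ℚᵘ.* ℚ.toℚᵘ (½^ n)       ≤⟨ ℚᵘₚ.*-monoʳ-≤-nonNeg ℚᵘ.½ (½^n≤1/[1+n] n) ⟩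
  ℚᵘ.½ ℚᵘ.* mkℚᵘ (+ 1) n        ≤⟨ ℚᵘ.*≤* (ℤ.+≤+ (ℕₚ.*-monoʳ-≤ 1 2+n≤2*[1+n])) ⟩
  mkℚᵘ (+ 1) (suc n)           ∎
  where
  open ℚᵘₚ.≤-Reasoning
  2+n≤2*[1+n] : suc (suc n) ℕ.≤ 2 ℕ.* suc n
  2+n≤2*[1+n] = ℕ.s≤s (subst (ℕ._≤ n ℕ.+ 1 ℕ.* suc n) (ℕₚ.+-comm n 1)
    (ℕₚ.+-monoʳ-≤ n (ℕ.s≤s ℕ.z≤n)))

½^-archimedean : ∀ ε → 0ℚ ℚ.< ε → ∃[ j ] ½^ j ℚ.< ε
-- Here ε = (p + 1) / (d + 1), because `d` stores the denominator minus one; so ½^(d + 1) ≤ 1 / (d +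
-- 2) < 1 / (d + 1) ≤ ε.
½^-archimedean ε@(mkℚ (+ suc p) d _) _ = suc d , ℚₚ.toℚᵘ-cancel-<
  (ℚᵘₚ.≤-<-trans (½^n≤1/[1+n] (suc d))
    (ℚᵘ.*<* (ℤ.+<+ (ℕₚ.*-mono-≤ {1} {suc p} (ℕ.s≤s ℕ.z≤n) ℕₚ.≤-refl))))
½^-archimedean (mkℚ (+ zero) d _) (ℚ.*<* (ℤ.+<+ ()))
½^-archimedean (mkℚ -[1+ p ] d _) (ℚ.*<* ())

shift : ℕ → ℝ → ℝ
shift k x = mkℝ (λ n → seq x (k ℕ.+ n)) λ ε 0<ε →
  let N , close = cauchy x ε 0<ε in
  N , λ m n N≤m N≤n → close (k ℕ.+ m) (k ℕ.+ n) (ℕₚ.m≤n⇒m≤o+n k N≤m) (ℕₚ.m≤n⇒m≤o+n k N≤n)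

shift-≈ : ∀ k x → shift k x ≈ x
shift-≈ k x ε 0<ε =
  let N , close = cauchy x ε 0<ε in N , λ n N≤n → close (k ℕ.+ n) n (ℕₚ.m≤n⇒m≤o+n k N≤n) N≤n

-- m ↦ (m² + c) / 2 maps [0, ½] to itself and contracts distances there, so
-- iterating it along the approximations of c converges to a fixed point.
module FixedPoint (c : ℝ) (0≤c : ∀ n → 0ℚ ℚ.≤ seq c n) (c≤¼ : ∀ n → seq c n ℚ.≤ ½ ℚ.* ½) where

  iterate : ℕ → ℚ
  iterate zero    = 0ℚ
  iterate (suc n) = ½ ℚ.* (iterate n ℚ.* iterate n ℚ.+ seq c n)

  0≤iterate : ∀ n → 0ℚ ℚ.≤ iterate n
  0≤iterate zero    = ℚₚ.≤-refl
  0≤iterate (suc n) = 0≤* (ℚₚ.<⇒≤ 0<½) (ℚₚ.+-mono-≤ (0≤square (iterate n)) (0≤c n))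

  iterate≤½ : ∀ n → iterate n ℚ.≤ ½
  iterate≤½ zero    = ℚₚ.<⇒≤ 0<½
  iterate≤½ (suc n) = 0≤-⇒≤ (subst (0ℚ ℚ.≤_) (eq (iterate n) (seq c n))
    (ℚₚ.+-mono-≤ (0≤* (ℚₚ.<⇒≤ 0<½) (≤⇒0≤- (c≤¼ n)))
      (ℚₚ.+-mono-≤ (0≤* (ℚₚ.<⇒≤ 0<½) (0≤* (≤⇒0≤- (iterate≤½ n)) (ℚₚ.+-mono-≤ (ℚₚ.<⇒≤ 0<½) (0≤iterate n)))) (ℚₚ.<⇒≤ 0<¼))))
    where
    0<¼ : 0ℚ ℚ.< ½ ℚ.* ½
    0<¼ = 0<½* 0<½
    eq : ∀ m c → ½ ℚ.* (½ ℚ.* ½ ℚ.- c) ℚ.+ (½ ℚ.* ((½ ℚ.- m) ℚ.* (½ ℚ.+ m)) ℚ.+ ½ ℚ.* ½)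
           ≡ ½ ℚ.- ½ ℚ.* (m ℚ.* m ℚ.+ c)
    eq = solve 2 (λ m c → con ½ :* (con ½ :* con ½ :- c) :+ (con ½ :* ((con ½ :- m) :* (con ½ :+ m)) :+ con ½ :* con ½)
           := con ½ :- con ½ :* (m :* m :+ c)) refl

  -- Factor p² - q² = (p - q) (p + q). Both iterates are at most ½, so p + q ≤ 1 and the outer ½
  -- survives as the contraction rate.
  contract : ∀ n k → ∣ iterate (suc n) ℚ.- iterate (suc k) ∣
               ℚ.≤ ½ ℚ.* (∣ iterate n ℚ.- iterate k ∣ ℚ.+ ∣ seq c n ℚ.- seq c k ∣)
  contract n k = begin
    ∣ ½ ℚ.* (p ℚ.* p ℚ.+ s) ℚ.- ½ ℚ.* (q ℚ.* q ℚ.+ t) ∣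
      ≡⟨ cong ∣_∣ (eq p q s t) ⟩
    ∣ ½ ℚ.* ((p ℚ.- q) ℚ.* (p ℚ.+ q) ℚ.+ (s ℚ.- t)) ∣
      ≡⟨ ℚₚ.∣p*q∣≡∣p∣*∣q∣ ½ ((p ℚ.- q) ℚ.* (p ℚ.+ q) ℚ.+ (s ℚ.- t)) ⟩
    ½ ℚ.* ∣ (p ℚ.- q) ℚ.* (p ℚ.+ q) ℚ.+ (s ℚ.- t) ∣
      ≤⟨ ℚₚ.*-monoˡ-≤-nonNeg ½ (ℚₚ.≤-trans (ℚₚ.∣p+q∣≤∣p∣+∣q∣ ((p ℚ.- q) ℚ.* (p ℚ.+ q)) (s ℚ.- t))
           (ℚₚ.+-monoˡ-≤ ∣ s ℚ.- t ∣ product≤)) ⟩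
    ½ ℚ.* (∣ p ℚ.- q ∣ ℚ.+ ∣ s ℚ.- t ∣) ∎
    where
    open ℚₚ.≤-Reasoning
    p q s t : ℚ
    p = iterate n
    q = iterate k
    s = seq c n
    t = seq c k

    eq : ∀ p q s t → ½ ℚ.* (p ℚ.* p ℚ.+ s) ℚ.- ½ ℚ.* (q ℚ.* q ℚ.+ t)
           ≡ ½ ℚ.* ((p ℚ.- q) ℚ.* (p ℚ.+ q) ℚ.+ (s ℚ.- t))
    eq = solve 4 (λ p q s t → con ½ :* (p :* p :+ s) :- con ½ :* (q :* q :+ t)
           := con ½ :* ((p :- q) :* (p :+ q) :+ (s :- t))) refl

    product≤ : ∣ (p ℚ.- q) ℚ.* (p ℚ.+ q) ∣ ℚ.≤ ∣ p ℚ.- q ∣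
    product≤ = begin
      ∣ (p ℚ.- q) ℚ.* (p ℚ.+ q) ∣     ≡⟨ ℚₚ.∣p*q∣≡∣p∣*∣q∣ (p ℚ.- q) (p ℚ.+ q) ⟩
      ∣ p ℚ.- q ∣ ℚ.* ∣ p ℚ.+ q ∣     ≡⟨ cong (∣ p ℚ.- q ∣ ℚ.*_) (ℚₚ.0≤p⇒∣p∣≡p (ℚₚ.+-mono-≤ (0≤iterate n) (0≤iterate k))) ⟩
      ∣ p ℚ.- q ∣ ℚ.* (p ℚ.+ q)       ≤⟨ ℚₚ.*-monoˡ-≤-nonNeg ∣ p ℚ.- q ∣ {{ℚₚ.∣-∣-nonNeg (p ℚ.- q)}}
                                           (ℚₚ.+-mono-≤ (iterate≤½ n) (iterate≤½ k)) ⟩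
      ∣ p ℚ.- q ∣ ℚ.* 1ℚ              ≡⟨ ℚₚ.*-identityʳ ∣ p ℚ.- q ∣ ⟩
      ∣ p ℚ.- q ∣                     ∎

  diameter : ∀ n k → ∣ iterate n ℚ.- iterate k ∣ ℚ.≤ 1ℚ
  diameter n k = ∣∣≤-intro (0≤-⇒≤ (subst (0ℚ ℚ.≤_) (eq₁ (iterate n) (iterate k)) (bound n k)))
                           (0≤-⇒≤ (subst (0ℚ ℚ.≤_) (eq₂ (iterate n) (iterate k)) (bound k n)))
    where
    bound : ∀ n k → 0ℚ ℚ.≤ (½ ℚ.- iterate n) ℚ.+ (½ ℚ.+ iterate k)
    bound n k = ℚₚ.+-mono-≤ (≤⇒0≤- (iterate≤½ n)) (ℚₚ.+-mono-≤ (ℚₚ.<⇒≤ 0<½) (0≤iterate k))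
    eq₁ : ∀ p q → (½ ℚ.- p) ℚ.+ (½ ℚ.+ q) ≡ 1ℚ ℚ.- (p ℚ.- q)
    eq₁ = solve 2 (λ p q → (con ½ :- p) :+ (con ½ :+ q) := con 1ℚ :- (p :- q)) refl
    eq₂ : ∀ p q → (½ ℚ.- q) ℚ.+ (½ ℚ.+ p) ≡ 1ℚ ℚ.- (ℚ.- (p ℚ.- q))
    eq₂ = solve 2 (λ p q → (con ½ :- q) :+ (con ½ :+ p) := con 1ℚ :- (:- (p :- q))) refl

  -- The initial distance, at most 1, is halved at each step, while the perturbations of `c` add up
  -- to at most η: indeed η is the fixed point of d ↦ (d + η) / 2.
  iterate-close : ∀ {N η} → (∀ m n → N ℕ.≤ m → N ℕ.≤ n → ∣ seq c m ℚ.- seq c n ∣ ℚ.< η) → 0ℚ ℚ.< η →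
                  ∀ j m n → N ℕ.≤ m → N ℕ.≤ n → ∣ iterate (j ℕ.+ m) ℚ.- iterate (j ℕ.+ n) ∣ ℚ.≤ ½^ j ℚ.+ η
  iterate-close {N} {η} close 0<η zero m n _ _ =
    ℚₚ.≤-trans (diameter m n) (subst (ℚ._≤ 1ℚ ℚ.+ η) (ℚₚ.+-identityʳ 1ℚ) (ℚₚ.+-monoʳ-≤ 1ℚ (ℚₚ.<⇒≤ 0<η)))
  iterate-close {N} {η} close 0<η (suc j) m n N≤m N≤n = begin
    ∣ iterate (suc (j ℕ.+ m)) ℚ.- iterate (suc (j ℕ.+ n)) ∣
      ≤⟨ contract (j ℕ.+ m) (j ℕ.+ n) ⟩
    ½ ℚ.* (∣ iterate (j ℕ.+ m) ℚ.- iterate (j ℕ.+ n) ∣ ℚ.+ ∣ seq c (j ℕ.+ m) ℚ.- seq c (j ℕ.+ n) ∣)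
      ≤⟨ ℚₚ.*-monoˡ-≤-nonNeg ½ (ℚₚ.+-mono-≤ (iterate-close close 0<η j m n N≤m N≤n)
           (ℚₚ.<⇒≤ (close (j ℕ.+ m) (j ℕ.+ n) (ℕₚ.m≤n⇒m≤o+n j N≤m) (ℕₚ.m≤n⇒m≤o+n j N≤n)))) ⟩
    ½ ℚ.* ((½^ j ℚ.+ η) ℚ.+ η)
      ≡⟨ eq (½^ j) η ⟩
    ½^ suc j ℚ.+ η ∎
    where
    open ℚₚ.≤-Reasoning
    eq : ∀ p e → ½ ℚ.* ((p ℚ.+ e) ℚ.+ e) ≡ ½ ℚ.* p ℚ.+ e
    eq = solve 2 (λ p e → con ½ :* ((p :+ e) :+ e) := con ½ :* p :+ e) refl

  iterate-cauchy : IsCauchy iterate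
  iterate-cauchy ε 0<ε = assemble (cauchy c η 0<η) (½^-archimedean η 0<η)
    where
    η : ℚ
    η = ½ ℚ.* ε
    0<η : 0ℚ ℚ.< η
    0<η = 0<½* 0<ε

    assemble : ∃[ N ] (∀ m n → N ℕ.≤ m → N ℕ.≤ n → ∣ seq c m ℚ.- seq c n ∣ ℚ.< η) → ∃[ j ] ½^ j ℚ.< η →
              ∃[ N ] (∀ m n → N ℕ.≤ m → N ℕ.≤ n → ∣ iterate m ℚ.- iterate n ∣ ℚ.< ε)
    -- Indices m, n ≥ j + N are rewritten as j + (m - j), j + (n - j): j steps of contraction,
    -- started where `c` is already η-close.
    assemble (N , close) (j , ½^j<η) = j ℕ.+ N , λ m n ≤m ≤n →
      subst₂ (λ k l → ∣ iterate k ℚ.- iterate l ∣ ℚ.< ε)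
        (ℕₚ.m+[n∸m]≡n (ℕₚ.m+n≤o⇒m≤o j ≤m)) (ℕₚ.m+[n∸m]≡n (ℕₚ.m+n≤o⇒m≤o j ≤n))
        (ℚₚ.≤-<-trans
          (iterate-close close 0<η j (m ℕ.∸ j) (n ℕ.∸ j) (N≤ ≤m) (N≤ ≤n))
          (subst (½^ j ℚ.+ η ℚ.<_) (½+½≡ ε) (ℚₚ.+-monoˡ-< η ½^j<η)))
      where
      N≤ : ∀ {n} → j ℕ.+ N ℕ.≤ n → N ℕ.≤ n ℕ.∸ j
      N≤ {n} ≤n = subst (ℕ._≤ n ℕ.∸ j) (ℕₚ.m+n∸m≡n j N) (ℕₚ.∸-monoˡ-≤ j ≤n)

  fixedPoint : ℝ
  fixedPoint = mkℝ iterate iterate-cauchy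

  -- At index `n` the right side is `iterate (suc n)` by definition, so the equation says that a
  -- Cauchy sequence equals its own shift.
  fixedPoint-≈ : fixedPoint ≈ fromℚ ½ * (fixedPoint * fixedPoint + c)
  fixedPoint-≈ = ≈-sym {fromℚ ½ * (fixedPoint * fixedPoint + c)} {fixedPoint} (shift-≈ 1 fixedPoint)

-- Complex arithmetic and sums over paired indices

2ℚ : ℚ
2ℚ = 1ℚ ℚ.+ 1ℚ

≈ᶜ-pointwise : ∀ {z w} → (∀ n → seq (re z) n ≡ seq (re w) n) → (∀ n → seq (im z) n ≡ seq (im w) n) → z ≈ᶜ w
≈ᶜ-pointwise {z} {w} re≡ im≡ = ≈-pointwise {re z} {re w} re≡ , ≈-pointwise {im z} {im w} im≡

≈ᶜ-refl : ∀ {z} → z ≈ᶜ z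
≈ᶜ-refl {z} = ≈-refl {re z} , ≈-refl {im z}

≈ᶜ-sym : ∀ {z w} → z ≈ᶜ w → w ≈ᶜ z
≈ᶜ-sym {z} {w} (p , q) = ≈-sym {re z} {re w} p , ≈-sym {im z} {im w} q

≈ᶜ-trans : ∀ {x y z} → x ≈ᶜ y → y ≈ᶜ z → x ≈ᶜ z
≈ᶜ-trans {x} {y} {z} (p , q) (p′ , q′) = ≈-trans {re x} {re y} {re z} p p′ , ≈-trans {im x} {im y} {im z} q q′

+ᶜ-cong : ∀ {x x′ y y′} → x ≈ᶜ x′ → y ≈ᶜ y′ → x +ᶜ y ≈ᶜ x′ +ᶜ y′
+ᶜ-cong {x} {x′} {y} {y′} (p , q) (p′ , q′) =
  +-cong {re x} {re x′} {re y} {re y′} p p′ , +-cong {im x} {im x′} {im y} {im y′} q q′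

+ᶜ-identityˡ : ∀ z → 0ᶜ +ᶜ z ≈ᶜ z
+ᶜ-identityˡ z = ≈ᶜ-pointwise {0ᶜ +ᶜ z} {z} (λ n → ℚₚ.+-identityˡ (seq (re z) n)) (λ n → ℚₚ.+-identityˡ (seq (im z) n))

+ᶜ-identityʳ : ∀ z → z +ᶜ 0ᶜ ≈ᶜ z
+ᶜ-identityʳ z = ≈ᶜ-pointwise {z +ᶜ 0ᶜ} {z} (λ n → ℚₚ.+-identityʳ (seq (re z) n)) (λ n → ℚₚ.+-identityʳ (seq (im z) n))

+ᶜ-assoc : ∀ x y z → (x +ᶜ y) +ᶜ z ≈ᶜ x +ᶜ (y +ᶜ z)
+ᶜ-assoc x y z = ≈ᶜ-pointwise {(x +ᶜ y) +ᶜ z} {x +ᶜ (y +ᶜ z)}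
  (λ n → ℚₚ.+-assoc (seq (re x) n) (seq (re y) n) (seq (re z) n))
  (λ n → ℚₚ.+-assoc (seq (im x) n) (seq (im y) n) (seq (im z) n))

+ᶜ-0ᶜ : ∀ {z w} → z ≈ᶜ 0ᶜ → w ≈ᶜ 0ᶜ → z +ᶜ w ≈ᶜ 0ᶜ
+ᶜ-0ᶜ {z} {w} (p , q) (p′ , q′) = ≈0-+ {re z} {re w} p p′ , ≈0-+ {im z} {im w} q q′

sumᶜ : ∀ {n} → Vector ℂ n → ℂ
sumᶜ = foldr _+ᶜ_ 0ᶜ

sumᶜ-zero : ∀ {n} (f : Vector ℂ n) → (∀ i → f i ≈ᶜ 0ᶜ) → sumᶜ f ≈ᶜ 0ᶜ
sumᶜ-zero {zero}  f f≈0 = ≈ᶜ-refl {0ᶜ}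
sumᶜ-zero {suc n} f f≈0 = +ᶜ-0ᶜ {f zero} {sumᶜ (f ∘ suc)} (f≈0 zero) (sumᶜ-zero (f ∘ suc) (f≈0 ∘ suc))

sumᶜ-single : ∀ {n} (f : Vector ℂ n) k → (∀ i → i ≢ k → f i ≈ᶜ 0ᶜ) → sumᶜ f ≈ᶜ f k
sumᶜ-single f zero off = ≈ᶜ-trans {sumᶜ f} {f zero +ᶜ 0ᶜ} {f zero}
  (+ᶜ-cong {f zero} {f zero} {sumᶜ (f ∘ suc)} {0ᶜ} (≈ᶜ-refl {f zero}) (sumᶜ-zero (f ∘ suc) λ i → off (suc i) λ ()))
  (+ᶜ-identityʳ (f zero))
sumᶜ-single f (suc k) off = ≈ᶜ-trans {sumᶜ f} {0ᶜ +ᶜ f (suc k)} {f (suc k)}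
  (+ᶜ-cong {f zero} {0ᶜ} {sumᶜ (f ∘ suc)} {f (suc k)} (off zero λ ())
    (sumᶜ-single (f ∘ suc) k λ i i≢k → off (suc i) (i≢k ∘ Finₚ.suc-injective)))
  (+ᶜ-identityˡ (f (suc k)))

sumᶜ-++ : ∀ a {b} (f : Vector ℂ (a ℕ.+ b)) → sumᶜ f ≈ᶜ sumᶜ (f ∘ (_↑ˡ b)) +ᶜ sumᶜ (f ∘ (a ↑ʳ_))
sumᶜ-++ zero    f = ≈ᶜ-sym {0ᶜ +ᶜ sumᶜ f} {sumᶜ f} (+ᶜ-identityˡ (sumᶜ f))
sumᶜ-++ (suc a) {b} f = ≈ᶜ-trans {f zero +ᶜ sumᶜ (f ∘ suc)} {f zero +ᶜ (s +ᶜ t)} {(f zero +ᶜ s) +ᶜ t}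
  (+ᶜ-cong {f zero} {f zero} {sumᶜ (f ∘ suc)} {s +ᶜ t} (≈ᶜ-refl {f zero}) (sumᶜ-++ a (f ∘ suc)))
  (≈ᶜ-sym {(f zero +ᶜ s) +ᶜ t} {f zero +ᶜ (s +ᶜ t)} (+ᶜ-assoc (f zero) s t))
  where
  s t : ℂ
  s = sumᶜ (f ∘ suc ∘ (_↑ˡ b))
  t = sumᶜ (f ∘ suc ∘ (a ↑ʳ_))

sumᶜ-combine : ∀ a {m} (f : Vector ℂ (a ℕ.* m)) → sumᶜ f ≈ᶜ sumᶜ λ i → sumᶜ λ k → f (combine {a} i k)
sumᶜ-combine zero        f = ≈ᶜ-refl {0ᶜ}
sumᶜ-combine (suc a) {m} f = ≈ᶜ-trans {sumᶜ f} {s +ᶜ sumᶜ (f ∘ (m ↑ʳ_))} {s +ᶜ t} (sumᶜ-++ m f)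
  (+ᶜ-cong {s} {s} {sumᶜ (f ∘ (m ↑ʳ_))} {t} (≈ᶜ-refl {s}) (sumᶜ-combine a (f ∘ (m ↑ʳ_))))
  where
  s t : ℂ
  s = sumᶜ (f ∘ (_↑ˡ (a ℕ.* m)))
  t = sumᶜ λ i → sumᶜ λ k → f (combine {suc a} (suc i) k)

sumᶜ-block : ∀ {m} (f : Vector ℂ (2 ℕ.* m)) (k : Fin m) →
             (∀ a l → l ≢ k → f (combine {2} a l) ≈ᶜ 0ᶜ) →
             sumᶜ f ≈ᶜ f (combine {2} zero k) +ᶜ f (combine {2} (suc zero) k)
sumᶜ-block {m} f k off = ≈ᶜ-trans {sumᶜ f} {s₀ +ᶜ (s₁ +ᶜ 0ᶜ)} {f₀ +ᶜ f₁} (sumᶜ-combine 2 {m} f)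
  (+ᶜ-cong {s₀} {f₀} {s₁ +ᶜ 0ᶜ} {f₁} (sumᶜ-single (λ l → f (combine {2} {m} zero l)) k (off zero))
    (≈ᶜ-trans {s₁ +ᶜ 0ᶜ} {s₁} {f₁} (+ᶜ-identityʳ s₁)
      (sumᶜ-single (λ l → f (combine {2} {m} (suc zero) l)) k (off (suc zero)))))
  where
  s₀ s₁ f₀ f₁ : ℂ
  s₀ = sumᶜ λ l → f (combine {2} {m} zero l)
  s₁ = sumᶜ λ l → f (combine {2} {m} (suc zero) l)
  f₀ = f (combine {2} {m} zero k)
  f₁ = f (combine {2} {m} (suc zero) k)

-- Multiplying by the conjugate of w turns w z into |w|² z, from whose two coordinates the positive
-- real |w|² can be cancelled.
*ᶜ≈0⇒≈0 : ∀ {w z} → Pos (re w * re w + im w * im w) → w *ᶜ z ≈ᶜ 0ᶜ → z ≈ᶜ 0ᶜ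
*ᶜ≈0⇒≈0 {wr +i wi} {a +i b} W>0 (p , q) =
  *≈0⇒≈0 {W} {a} W>0 (≈0-resp {wr * X + wi * Y} {W * a}
    (λ n → eqr (seq wr n) (seq wi n) (seq a n) (seq b n))
    (≈0-+ {wr * X} {wi * Y} (*-zeroʳ-≈ wr {X} p) (*-zeroʳ-≈ wi {Y} q))) ,
  *≈0⇒≈0 {W} {b} W>0 (≈0-resp {wr * Y + (- wi) * X} {W * b}
    (λ n → eqi (seq wr n) (seq wi n) (seq a n) (seq b n))
    (≈0-+ {wr * Y} {(- wi) * X} (*-zeroʳ-≈ wr {Y} q) (*-zeroʳ-≈ (- wi) {X} p)))
  where
  W X Y : ℝ
  W = wr * wr + wi * wi
  X = wr * a + - (wi * b)
  Y = wr * b + wi * a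
  eqr : ∀ p q a b → p ℚ.* (p ℚ.* a ℚ.+ ℚ.- (q ℚ.* b)) ℚ.+ q ℚ.* (p ℚ.* b ℚ.+ q ℚ.* a) ≡ (p ℚ.* p ℚ.+ q ℚ.* q) ℚ.* a
  eqr = solve 4 (λ p q a b → p :* (p :* a :+ :- (q :* b)) :+ q :* (p :* b :+ q :* a) := (p :* p :+ q :* q) :* a) refl
  eqi : ∀ p q a b → p ℚ.* (p ℚ.* b ℚ.+ q ℚ.* a) ℚ.+ (ℚ.- q) ℚ.* (p ℚ.* a ℚ.+ ℚ.- (q ℚ.* b)) ≡ (p ℚ.* p ℚ.+ q ℚ.* q) ℚ.* b
  eqi = solve 4 (λ p q a b → p :* (p :* b :+ q :* a) :+ (:- q) :* (p :* a :+ :- (q :* b)) := (p :* p :+ q :* q) :* b) refl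

-- Characteristic polynomial and kernel of a single block

charPoly : ℝ → ℂ → ℂ
charPoly β (r +i t) = (((r + r) + β * β + r * r) + - (t * t)) +i ((t + t) * (r + fromℚ 1ℚ))

-- On the half plane Re μ > -1 the square of the modulus of μ² + 2μ + β² is
-- bounded below via K = r² + 2r + β²: its real part is K - t², its imaginary
-- part is 2t(r + 1), and one of K - t² and t² is positive once K is.
charPoly-nonzero : ∀ β μ → Pos (β * β) →
  Pos (- re μ) ⊎ Pos (re (charPoly β μ) * re (charPoly β μ) + im (charPoly β μ) * im (charPoly β μ))
-- With k = 2r + β², the splitting β² = k + (-2r) gives k > 0 or r < 0 at once; then 1 = (r + 1) +
-- (-r) gives r > -1 or r < 0.
charPoly-nonzero β μ@(r +i t) β²>0 = from-K (Pos-cotrans {k} { - r + - r} (Pos-resp {β * β} {k + (- r + - r)}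
    (λ n → split (seq r n) (seq β n)) β²>0))
  where
  k K wr wi R : ℝ
  k = (r + r) + β * β
  K = k + r * r
  wr = re (charPoly β μ)
  wi = im (charPoly β μ)
  R = r + fromℚ 1ℚ

  Goal : Set
  Goal = Pos (- r) ⊎ Pos (wr * wr + wi * wi)

  split : ∀ r b → b ℚ.* b ≡ (r ℚ.+ r ℚ.+ b ℚ.* b) ℚ.+ (ℚ.- r ℚ.+ ℚ.- r)
  split = solve 2 (λ r b → b :* b := (r :+ r :+ b :* b) :+ (:- r :+ :- r)) refl

  wi² : ∀ r t → (2ℚ ℚ.* 2ℚ) ℚ.* ((t ℚ.* t) ℚ.* ((r ℚ.+ 1ℚ) ℚ.* (r ℚ.+ 1ℚ))) ≡
                ((t ℚ.+ t) ℚ.* (r ℚ.+ 1ℚ)) ℚ.* ((t ℚ.+ t) ℚ.* (r ℚ.+ 1ℚ))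
  wi² = solve 2 (λ r t → con (2ℚ ℚ.* 2ℚ) :* ((t :* t) :* ((r :+ con 1ℚ) :* (r :+ con 1ℚ))) :=
                ((t :+ t) :* (r :+ con 1ℚ)) :* ((t :+ t) :* (r :+ con 1ℚ))) refl

  K-split : ∀ k t → k ≡ (k ℚ.+ ℚ.- (t ℚ.* t)) ℚ.+ t ℚ.* t
  K-split = solve 2 (λ k t → k := (k :+ :- (t :* t)) :+ t :* t) refl

  conclude : Pos R → Pos wr ⊎ Pos (t * t) → Goal
  conclude R>0 (inj₁ wr>0) = inj₂ (Pos-+-nonNeg {wr * wr} {wi * wi} (Pos-* {wr} {wr} wr>0 wr>0) λ n → 0≤square (seq wi n))
  conclude R>0 (inj₂ t²>0) = inj₂ (Pos-resp {wi * wi + wr * wr} {wr * wr + wi * wi}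
    (λ n → ℚₚ.+-comm (seq wi n ℚ.* seq wi n) (seq wr n ℚ.* seq wr n))
    (Pos-+-nonNeg {wi * wi} {wr * wr}
      (Pos-resp {fromℚ (2ℚ ℚ.* 2ℚ) * ((t * t) * (R * R))} {wi * wi} (λ n → wi² (seq r n) (seq t n))
        (Pos-* {fromℚ (2ℚ ℚ.* 2ℚ)} {(t * t) * (R * R)} (Pos-const (ℚₚ.positive⁻¹ (2ℚ ℚ.* 2ℚ)))
          (Pos-* {t * t} {R * R} t²>0 (Pos-* {R} {R} R>0 R>0))))
      λ n → 0≤square (seq wr n)))

  from-R : Pos k → Pos R ⊎ Pos (- r) → Goal
  from-R k>0 (inj₂ r<0) = inj₁ r<0
  from-R k>0 (inj₁ R>0) = conclude R>0 (Pos-cotrans {wr} {t * t}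
    (Pos-resp {K} {wr + t * t} (λ n → K-split (seq K n) (seq t n))
      (Pos-+-nonNeg {k} {r * r} k>0 λ n → 0≤square (seq r n))))

  one : ∀ r → 1ℚ ≡ (r ℚ.+ 1ℚ) ℚ.+ ℚ.- r
  one = solve 1 (λ r → con 1ℚ := (r :+ con 1ℚ) :+ :- r) refl

  from-K : Pos k ⊎ Pos (- r + - r) → Goal
  from-K (inj₁ k>0) = from-R k>0 (Pos-cotrans {R} { - r} (Pos-resp {fromℚ 1ℚ} {R + - r}
    (λ n → one (seq r n)) (Pos-const 0<1)))
  from-K (inj₂ h)   = inj₁ ([ id , id ]′ (Pos-cotrans { - r} { - r} h))

≈ᶜ⇒-≈0 : ∀ {z w} → z ≈ᶜ w → (re z + - re w ≈ 0ℝ) × (im z + - im w ≈ 0ℝ)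
≈ᶜ⇒-≈0 {z} {w} (p , q) = ≈⇒-≈0 {re z} {re w} p , ≈⇒-≈0 {im z} {im w} q

≈0-combine₃ : ∀ p q r {x y z} → x ≈ 0ℝ → y ≈ 0ℝ → z ≈ 0ℝ → p * x + q * y + r * z ≈ 0ℝ
≈0-combine₃ p q r {x} {y} {z} x≈0 y≈0 z≈0 = ≈0-+ {p * x + q * y} {r * z}
  (≈0-+ {p * x} {q * y} (*-zeroʳ-≈ p {x} x≈0) (*-zeroʳ-≈ q {y} y≈0)) (*-zeroʳ-≈ r {z} z≈0)

-- (μ² + 2μ + β²) v₁ and (μ² + 2μ + β²) v₂ are combinations of the residuals
-- E = μ v₁ - β v₂ and G = μ v₂ + β v₁ + 2 v₂.
block-kernel : ∀ β μ v₁ v₂ → Pos (β * β) →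
  μ *ᶜ v₁ ≈ᶜ fromℝ β *ᶜ v₂ →
  μ *ᶜ v₂ ≈ᶜ fromℝ (- β) *ᶜ v₁ +ᶜ fromℝ (fromℚ (ℚ.- 2ℚ)) *ᶜ v₂ →
  Pos (- re μ) ⊎ (v₁ ≈ᶜ 0ᶜ × v₂ ≈ᶜ 0ᶜ)
block-kernel β μ@(r +i t) v₁@(a +i b) v₂@(c +i d) β²>0 eq₁ eq₂ = decide (charPoly-nonzero β μ β²>0)
  where
  w : ℂ
  w = charPoly β μ

  z₁ z₂ : ℂ
  z₁ = fromℝ β *ᶜ v₂
  z₂ = fromℝ (- β) *ᶜ v₁ +ᶜ fromℝ (fromℚ (ℚ.- 2ℚ)) *ᶜ v₂

  Er Ei Gr Gi : ℝ
  Er = re (μ *ᶜ v₁) + - re z₁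
  Ei = im (μ *ᶜ v₁) + - im z₁
  Gr = re (μ *ᶜ v₂) + - re z₂
  Gi = im (μ *ᶜ v₂) + - im z₂

  Er≈0 : Er ≈ 0ℝ
  Er≈0 = proj₁ (≈ᶜ⇒-≈0 {μ *ᶜ v₁} {z₁} eq₁)
  Ei≈0 : Ei ≈ 0ℝ
  Ei≈0 = proj₂ (≈ᶜ⇒-≈0 {μ *ᶜ v₁} {z₁} eq₁)
  Gr≈0 : Gr ≈ 0ℝ
  Gr≈0 = proj₁ (≈ᶜ⇒-≈0 {μ *ᶜ v₂} {z₂} eq₂)
  Gi≈0 : Gi ≈ 0ℝ
  Gi≈0 = proj₂ (≈ᶜ⇒-≈0 {μ *ᶜ v₂} {z₂} eq₂)

  r+2 : ℝ
  r+2 = r + fromℚ 2ℚ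

  -- The coefficients are the rows of the adjugate ((μ + 2 , β) , (-β , μ)) of μ minus the block,
  -- written out in real and imaginary parts.
  wv₁≈0 : w *ᶜ v₁ ≈ᶜ 0ᶜ
  wv₁≈0 =
    ≈0-resp {r+2 * Er + (- t) * Ei + β * Gr} {re (w *ᶜ v₁)}
      (λ n → solve 7 (λ r t e a b c d →
        (r :+ con 2ℚ) :* ((r :* a :+ :- (t :* b)) :+ :- (e :* c :+ :- (con 0ℚ :* d)))
        :+ (:- t) :* ((r :* b :+ t :* a) :+ :- (e :* d :+ con 0ℚ :* c))
        :+ e :* ((r :* c :+ :- (t :* d)) :+ :- (((:- e) :* a :+ :- (con 0ℚ :* b)) :+ (con (ℚ.- 2ℚ) :* c :+ :- (con 0ℚ :* d))))
        := (r :+ r :+ e :* e :+ r :* r :+ :- (t :* t)) :* a :+ :- (((t :+ t) :* (r :+ con 1ℚ)) :* b)) refl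
        (seq r n) (seq t n) (seq β n) (seq a n) (seq b n) (seq c n) (seq d n))
      (≈0-combine₃ r+2 (- t) β {Er} {Ei} {Gr} Er≈0 Ei≈0 Gr≈0) ,
    ≈0-resp {r+2 * Ei + t * Er + β * Gi} {im (w *ᶜ v₁)}
      (λ n → solve 7 (λ r t e a b c d →
        (r :+ con 2ℚ) :* ((r :* b :+ t :* a) :+ :- (e :* d :+ con 0ℚ :* c))
        :+ t :* ((r :* a :+ :- (t :* b)) :+ :- (e :* c :+ :- (con 0ℚ :* d)))
        :+ e :* ((r :* d :+ t :* c) :+ :- (((:- e) :* b :+ con 0ℚ :* a) :+ (con (ℚ.- 2ℚ) :* d :+ con 0ℚ :* c)))
        := (r :+ r :+ e :* e :+ r :* r :+ :- (t :* t)) :* b :+ ((t :+ t) :* (r :+ con 1ℚ)) :* a) refl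
        (seq r n) (seq t n) (seq β n) (seq a n) (seq b n) (seq c n) (seq d n))
      (≈0-combine₃ r+2 t β {Ei} {Er} {Gi} Ei≈0 Er≈0 Gi≈0)

  wv₂≈0 : w *ᶜ v₂ ≈ᶜ 0ᶜ
  wv₂≈0 =
    ≈0-resp {r * Gr + (- t) * Gi + (- β) * Er} {re (w *ᶜ v₂)}
      (λ n → solve 7 (λ r t e a b c d →
        r :* ((r :* c :+ :- (t :* d)) :+ :- (((:- e) :* a :+ :- (con 0ℚ :* b)) :+ (con (ℚ.- 2ℚ) :* c :+ :- (con 0ℚ :* d))))
        :+ (:- t) :* ((r :* d :+ t :* c) :+ :- (((:- e) :* b :+ con 0ℚ :* a) :+ (con (ℚ.- 2ℚ) :* d :+ con 0ℚ :* c)))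
        :+ (:- e) :* ((r :* a :+ :- (t :* b)) :+ :- (e :* c :+ :- (con 0ℚ :* d)))
        := (r :+ r :+ e :* e :+ r :* r :+ :- (t :* t)) :* c :+ :- (((t :+ t) :* (r :+ con 1ℚ)) :* d)) refl
        (seq r n) (seq t n) (seq β n) (seq a n) (seq b n) (seq c n) (seq d n))
      (≈0-combine₃ r (- t) (- β) {Gr} {Gi} {Er} Gr≈0 Gi≈0 Er≈0) ,
    ≈0-resp {r * Gi + t * Gr + (- β) * Ei} {im (w *ᶜ v₂)}
      (λ n → solve 7 (λ r t e a b c d →
        r :* ((r :* d :+ t :* c) :+ :- (((:- e) :* b :+ con 0ℚ :* a) :+ (con (ℚ.- 2ℚ) :* d :+ con 0ℚ :* c)))
        :+ t :* ((r :* c :+ :- (t :* d)) :+ :- (((:- e) :* a :+ :- (con 0ℚ :* b)) :+ (con (ℚ.- 2ℚ) :* c :+ :- (con 0ℚ :* d))))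
        :+ (:- e) :* ((r :* b :+ t :* a) :+ :- (e :* d :+ con 0ℚ :* c))
        := (r :+ r :+ e :* e :+ r :* r :+ :- (t :* t)) :* d :+ ((t :+ t) :* (r :+ con 1ℚ)) :* c) refl
        (seq r n) (seq t n) (seq β n) (seq a n) (seq b n) (seq c n) (seq d n))
      (≈0-combine₃ r t (- β) {Gi} {Gr} {Ei} Gi≈0 Gr≈0 Ei≈0)

  decide : Pos (- re μ) ⊎ Pos (re w * re w + im w * im w) → Pos (- re μ) ⊎ (v₁ ≈ᶜ 0ᶜ × v₂ ≈ᶜ 0ᶜ)
  decide (inj₁ r<0)  = inj₁ r<0
  decide (inj₂ w²>0) = inj₂ (*ᶜ≈0⇒≈0 {w} {v₁} w²>0 wv₁≈0 , *ᶜ≈0⇒≈0 {w} {v₂} w²>0 wv₂≈0)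

-- The block diagonal pencil and its rows

ι : ℕ → ℚ
ι zero    = 0ℚ
ι (suc n) = 1ℚ ℚ.+ ι n

0≤ι : ∀ n → 0ℚ ℚ.≤ ι n
0≤ι zero    = ℚₚ.≤-refl
0≤ι (suc n) = ℚₚ.+-mono-≤ (ℚₚ.<⇒≤ 0<1) (0≤ι n)

ι-mono-≤ : ∀ {m n} → m ℕ.≤ n → ι m ℚ.≤ ι n
ι-mono-≤ {n = n} ℕ.z≤n = 0≤ι n
ι-mono-≤ (ℕ.s≤s m≤n)   = ℚₚ.+-monoʳ-≤ 1ℚ (ι-mono-≤ m≤n)

Blocks : ℕ → Set
Blocks m = Fin m → Fin 2 → Fin 2 → ℚ

select : ∀ {A : Set} {m} → Fin m → Fin m → A → A → A
select k l x y = if does (k Finₚ.≟ l) then x else y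

select-≡ : ∀ {A : Set} {m} (k : Fin m) {x y : A} → select k k x y ≡ x
select-≡ k {x} {y} = cong (if_then x else y) (dec-true (k Finₚ.≟ k) refl)

select-≢ : ∀ {A : Set} {m} {k l : Fin m} {x y : A} → k ≢ l → select k l x y ≡ y
select-≢ {k = k} {l} {x} {y} k≢l = cong (if_then x else y) (dec-false (k Finₚ.≟ l) k≢l)

entry : ∀ {m} → Blocks m → Fin 2 × Fin m → Fin 2 × Fin m → ℚ
entry B (a , k) (b , l) = select k l (B k a b) 0ℚ

-- `combine a k` is coordinate `a` of block `k`, so the first coordinates of all blocks precede all
-- second ones: the matrix is block diagonal up to a permutation of the basis.
blockDiagonal : ∀ {m} → Blocks m → Matrix (2 ℕ.* m)
blockDiagonal {m} B i j = fromℚ (entry B (remQuot {2} m i) (remQuot {2} m j))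

entry-combine : ∀ {m} (B : Blocks m) a k b l →
  entry B (remQuot {2} m (combine {2} a k)) (remQuot {2} m (combine {2} b l)) ≡ entry B (a , k) (b , l)
entry-combine B a k b l = cong₂ (entry B) (Finₚ.remQuot-combine {2} a k) (Finₚ.remQuot-combine {2} b l)

scale : ℝ → ℚ → ℚ → ℂ → ℂ
scale x p q z = fromℝ (fromℚ p + x * fromℚ q) *ᶜ z

scale-00 : ∀ x z → scale x 0ℚ 0ℚ z ≈ᶜ 0ᶜ
scale-00 x z = ≈ᶜ-pointwise {scale x 0ℚ 0ℚ z} {0ᶜ}
  (λ n → solve 3 (λ x a b → (con 0ℚ :+ x :* con 0ℚ) :* a :+ :- (con 0ℚ :* b) := con 0ℚ) refl
    (seq x n) (seq (re z) n) (seq (im z) n))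
  (λ n → solve 3 (λ x a b → (con 0ℚ :+ x :* con 0ℚ) :* b :+ con 0ℚ :* a := con 0ℚ) refl
    (seq x n) (seq (re z) n) (seq (im z) n))

blockValue : ∀ {m} → Blocks m → Blocks m → ℝ → Vector ℂ (2 ℕ.* m) → Fin 2 → Fin m → ℂ
blockValue B C x v a k =
  scale x (B k a zero) (C k a zero) (v (combine {2} zero k)) +ᶜ
  scale x (B k a (suc zero)) (C k a (suc zero)) (v (combine {2} (suc zero) k))

module _ {m} (M N : Matrix (2 ℕ.* m)) (B C : Blocks m)
         (M-seq : ∀ i j n → seq (M i j) n ≡ entry B (remQuot {2} m i) (remQuot {2} m j))
         (N-seq : ∀ i j n → seq (N i j) n ≡ entry C (remQuot {2} m i) (remQuot {2} m j)) where

  blockRow : ∀ x (v : Vector ℂ (2 ℕ.* m)) a k →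
    (pencil M N x · v) (combine {2} a k) ≈ᶜ blockValue B C x v a k
  blockRow x v a k = ≈ᶜ-trans {sumᶜ f} {f (combine {2} zero k) +ᶜ f (combine {2} (suc zero) k)} {on zero +ᶜ on (suc zero)}
    (sumᶜ-block {m} f k off)
    (+ᶜ-cong {f (combine {2} zero k)} {on zero} {f (combine {2} (suc zero) k)} {on (suc zero)}
      (f-on zero) (f-on (suc zero)))
    where
    f : Vector ℂ (2 ℕ.* m)
    f j = fromℝ (pencil M N x (combine {2} a k) j) *ᶜ v j

    on : Fin 2 → ℂ
    on b = scale x (B k a b) (C k a b) (v (combine {2} b k))

    f-entry : ∀ b l {p q} → entry B (a , k) (b , l) ≡ p → entry C (a , k) (b , l) ≡ q →
      f (combine {2} b l) ≈ᶜ scale x p q (v (combine {2} b l))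
    f-entry b l {p} {q} B≡p C≡q = ≈ᶜ-pointwise {f (combine {2} b l)} {scale x p q z}
      (λ n → cong₂ (λ p q → (p ℚ.+ seq x n ℚ.* q) ℚ.* seq (re z) n ℚ.+ ℚ.- (0ℚ ℚ.* seq (im z) n)) (Bp n) (Cq n))
      (λ n → cong₂ (λ p q → (p ℚ.+ seq x n ℚ.* q) ℚ.* seq (im z) n ℚ.+ 0ℚ ℚ.* seq (re z) n) (Bp n) (Cq n))
      where
      z : ℂ
      z = v (combine {2} b l)
      Bp : ∀ n → seq (M (combine {2} a k) (combine {2} b l)) n ≡ p
      Bp n = trans (M-seq _ _ n) (trans (entry-combine B a k b l) B≡p)
      Cq : ∀ n → seq (N (combine {2} a k) (combine {2} b l)) n ≡ q
      Cq n = trans (N-seq _ _ n) (trans (entry-combine C a k b l) C≡q)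

    f-on : ∀ b → f (combine {2} b k) ≈ᶜ on b
    f-on b = f-entry b k (select-≡ k) (select-≡ k)

    off : ∀ b l → l ≢ k → f (combine {2} b l) ≈ᶜ 0ᶜ
    off b l l≢k = ≈ᶜ-trans {f (combine {2} b l)} {scale x 0ℚ 0ℚ (v (combine {2} b l))} {0ᶜ}
      (f-entry b l (select-≢ (l≢k ∘ sym)) (select-≢ (l≢k ∘ sym))) (scale-00 x (v (combine {2} b l)))

-- The k-th diagonal block of F + αH is ((0 , β) , (-β , -2)) with β = α + k + 1.
F-block H-block : ∀ {m} → Blocks m
F-block k zero       zero       = 0ℚ
F-block k zero       (suc zero) = ι (suc (toℕ k))
F-block k (suc zero) zero       = ℚ.- ι (suc (toℕ k))
F-block k (suc zero) (suc zero) = ℚ.- 2ℚ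
H-block k zero       zero       = 0ℚ
H-block k zero       (suc zero) = 1ℚ
H-block k (suc zero) zero       = ℚ.- 1ℚ
H-block k (suc zero) (suc zero) = 0ℚ

F H : ∀ m → Matrix (2 ℕ.* m)
F m = blockDiagonal {m} F-block
H m = blockDiagonal {m} H-block

β : ∀ {m} → Fin m → ℝ → ℝ
β k x = x + fromℚ (ι (suc (toℕ k)))

rowValue : ℝ → Fin 2 → ℂ → ℂ → ℂ
rowValue b zero       z w = fromℝ b *ᶜ w
rowValue b (suc zero) z w = fromℝ (- b) *ᶜ z +ᶜ fromℝ (fromℚ (ℚ.- 2ℚ)) *ᶜ w

row : ∀ {m} x (v : Vector ℂ (2 ℕ.* m)) a k →
  (pencil (F m) (H m) x · v) (combine {2} a k) ≈ᶜ
    rowValue (β k x) a (v (combine {2} zero k)) (v (combine {2} (suc zero) k))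
row {m} x v a k = ≈ᶜ-trans {(pencil (F m) (H m) x · v) (combine {2} a k)} {blockValue F-block H-block x v a k} {rowValue (β k x) a z w}
  (blockRow {m} (F m) (H m) F-block H-block (λ _ _ _ → refl) (λ _ _ _ → refl) x v a k) (value a)
  where
  i : ℚ
  i = ι (suc (toℕ k))
  z w : ℂ
  z = v (combine {2} zero k)
  w = v (combine {2} (suc zero) k)

  value : ∀ a → blockValue F-block H-block x v a k ≈ᶜ rowValue (β k x) a z w
  value zero = ≈ᶜ-pointwise {blockValue F-block H-block x v zero k} {rowValue (β k x) zero z w}
    (λ n → solve 6 (λ x i a b c d →
       ((con 0ℚ :+ x :* con 0ℚ) :* a :+ :- (con 0ℚ :* b)) :+ ((i :+ x :* con 1ℚ) :* c :+ :- (con 0ℚ :* d))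
       := (x :+ i) :* c :+ :- (con 0ℚ :* d)) refl
       (seq x n) i (seq (re z) n) (seq (im z) n) (seq (re w) n) (seq (im w) n))
    (λ n → solve 6 (λ x i a b c d →
       ((con 0ℚ :+ x :* con 0ℚ) :* b :+ con 0ℚ :* a) :+ ((i :+ x :* con 1ℚ) :* d :+ con 0ℚ :* c)
       := (x :+ i) :* d :+ con 0ℚ :* c) refl
       (seq x n) i (seq (re z) n) (seq (im z) n) (seq (re w) n) (seq (im w) n))
  value (suc zero) = ≈ᶜ-pointwise {blockValue F-block H-block x v (suc zero) k} {rowValue (β k x) (suc zero) z w}
    (λ n → solve 6 (λ x i a b c d →
       ((:- i :+ x :* con (ℚ.- 1ℚ)) :* a :+ :- (con 0ℚ :* b)) :+ ((con (ℚ.- 2ℚ) :+ x :* con 0ℚ) :* c :+ :- (con 0ℚ :* d))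
       := ((:- (x :+ i)) :* a :+ :- (con 0ℚ :* b)) :+ (con (ℚ.- 2ℚ) :* c :+ :- (con 0ℚ :* d))) refl
       (seq x n) i (seq (re z) n) (seq (im z) n) (seq (re w) n) (seq (im w) n))
    (λ n → solve 6 (λ x i a b c d →
       ((:- i :+ x :* con (ℚ.- 1ℚ)) :* b :+ con 0ℚ :* a) :+ ((con (ℚ.- 2ℚ) :+ x :* con 0ℚ) :* d :+ con 0ℚ :* c)
       := ((:- (x :+ i)) :* b :+ con 0ℚ :* a) :+ (con (ℚ.- 2ℚ) :* d :+ con 0ℚ :* c)) refl
       (seq x n) i (seq (re z) n) (seq (im z) n) (seq (re w) n) (seq (im w) n))

-- Stability as apartness of every β from zero

⊎-distrib-∀ : ∀ {m} {P : Set} {Q : Fin m → Set} → (∀ k → P ⊎ Q k) → P ⊎ (∀ k → Q k)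
⊎-distrib-∀ {zero}  f = inj₂ λ ()
⊎-distrib-∀ {suc m} {P} {Q} f = combine′ (f zero) (⊎-distrib-∀ (f ∘ suc))
  where
  combine′ : P ⊎ Q zero → P ⊎ (∀ k → Q (suc k)) → P ⊎ (∀ k → Q k)
  combine′ (inj₁ p) _        = inj₁ p
  combine′ (inj₂ q) (inj₁ p) = inj₁ p
  combine′ (inj₂ q) (inj₂ r) = inj₂ λ { zero → q ; (suc k) → r k }

∀-combine : ∀ {m} {P : Fin (2 ℕ.* m) → Set} → (∀ a k → P (combine {2} {m} a k)) → ∀ i → P i
∀-combine {m} {P} h i = subst P (Finₚ.combine-remQuot {2} m i) (h (proj₁ (remQuot {2} m i)) (proj₂ (remQuot {2} m i)))

Neg⇒<0 : ∀ {x} → Pos (- x) → x < 0ℝ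
Neg⇒<0 {x} h = Pos⇒< {x} {0ℝ} (Pos-resp { - x} {0ℝ + - x} (λ n → sym (ℚₚ.+-identityˡ (ℚ.- seq x n))) h)

<0⇒Neg : ∀ {x} → x < 0ℝ → Pos (- x)
<0⇒Neg {x} h = Pos-resp {0ℝ + - x} { - x} (λ n → ℚₚ.+-identityˡ (ℚ.- seq x n)) (<⇒Pos {x} {0ℝ} h)

-- All that both stability lemmas use of the pencil is its action on vectors; behind this interface
-- the matrix stays abstract.
RowsOf : ∀ {m} → (Fin m → ℝ) → Matrix (2 ℕ.* m) → Set
RowsOf {m} b A = ∀ (v : Vector ℂ (2 ℕ.* m)) a k →
  (A · v) (combine {2} a k) ≈ᶜ rowValue (b k) a (v (combine {2} zero k)) (v (combine {2} (suc zero) k))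

-- The eigenvector offers no nonzero coordinate to start from. A finite search over the blocks
-- either meets one that proves Re μ < 0 or shows every coordinate to vanish, which refutes the
-- eigenvector.
apart⇒stable : ∀ {m} (b : Fin m → ℝ) (A : Matrix (2 ℕ.* m)) → RowsOf b A →
  (∀ k → Pos (b k * b k)) → Stable A
apart⇒stable {m} b A rows b²>0 μ (v , v≢0 , eig) = conclude (⊎-distrib-∀ block)
  where
  Zero : Fin m → Set
  Zero k = v (combine {2} zero k) ≈ᶜ 0ᶜ × v (combine {2} (suc zero) k) ≈ᶜ 0ᶜ

  eigen : ∀ a k → μ *ᶜ v (combine {2} a k) ≈ᶜ rowValue (b k) a (v (combine {2} zero k)) (v (combine {2} (suc zero) k))
  eigen a k = ≈ᶜ-trans {μ *ᶜ v (combine {2} a k)} {(A · v) (combine {2} a k)}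
    {rowValue (b k) a (v (combine {2} zero k)) (v (combine {2} (suc zero) k))}
    (≈ᶜ-sym {(A · v) (combine {2} a k)} {μ *ᶜ v (combine {2} a k)} (eig (combine {2} a k)))
    (rows v a k)

  block : ∀ k → Pos (- re μ) ⊎ Zero k
  block k = block-kernel (b k) μ (v (combine {2} zero k)) (v (combine {2} (suc zero) k)) (b²>0 k)
    (eigen zero k) (eigen (suc zero) k)

  pick : (∀ k → Zero k) → ∀ a k → v (combine {2} a k) ≈ᶜ 0ᶜ
  pick z zero       k = proj₁ (z k)
  pick z (suc zero) k = proj₂ (z k)

  conclude : Pos (- re μ) ⊎ (∀ k → Zero k) → re μ < 0ℝ
  conclude (inj₁ r<0) = Neg⇒<0 {re μ} r<0
  conclude (inj₂ z)   = ⊥-elim (v≢0 (∀-combine {m} {λ i → v i ≈ᶜ 0ᶜ} (pick z)))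

-- b² ≤ ¼ is known only from index `N` on, so the iteration runs on that tail of b², which is the
-- same real. The bound `½` is kept because it later makes 2 - m positive.
small-root : ∀ b → Pos (fromℚ (½ ℚ.* ½) + - (b * b)) →
  Σ[ m ∈ ℝ ] (∀ n → seq m n ℚ.≤ ½) × m ≈ fromℚ ½ * (m * m + b * b)
small-root b (ε , 0<ε , N , ev) = fixedPoint , iterate≤½ ,
  ≈-trans {fixedPoint} {fromℚ ½ * (fixedPoint * fixedPoint + shift N (b * b))} {fromℚ ½ * (fixedPoint * fixedPoint + b * b)}
    fixedPoint-≈
    (-≈0⇒≈ {fromℚ ½ * (fixedPoint * fixedPoint + shift N (b * b))} {fromℚ ½ * (fixedPoint * fixedPoint + b * b)}
      (≈0-resp {fromℚ ½ * (shift N (b * b) + - (b * b))}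
        {fromℚ ½ * (fixedPoint * fixedPoint + shift N (b * b)) + - (fromℚ ½ * (fixedPoint * fixedPoint + b * b))}
        (λ n → solve 3 (λ m c d → con ½ :* (c :+ :- d) := con ½ :* (m :* m :+ c) :+ :- (con ½ :* (m :* m :+ d))) refl
          (iterate n) (seq (b * b) (N ℕ.+ n)) (seq (b * b) n))
        (*-zeroʳ-≈ (fromℚ ½) {shift N (b * b) + - (b * b)}
          (≈⇒-≈0 {shift N (b * b)} {b * b} (shift-≈ N (b * b))))))
  where
  open FixedPoint (shift N (b * b)) (λ n → 0≤square (seq b (N ℕ.+ n)))
    (λ n → ℚₚ.<⇒≤ (0<-⇒< (ℚₚ.<-trans 0<ε (ev (N ℕ.+ n) (ℕₚ.m≤m+n N n)))))

stable⇒apart : ∀ {m} (β : Fin m → ℝ) (A : Matrix (2 ℕ.* m)) → RowsOf β A →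
  Stable A → ∀ k → Pos (β k) ⊎ Pos (- β k)
stable⇒apart {m} β A rows stable k = above (Pos-cotrans {b + h} { - b}
    (Pos-resp {h} {b + h + - b} (λ n → solve 1 (λ b → con ½ := b :+ con ½ :+ :- b) refl (seq b n)) (Pos-const 0<½)))
  where
  b h : ℝ
  b = β k
  h = fromℚ ½

  Goal : Set
  Goal = Pos b ⊎ Pos (- b)

  fromRoot : Σ[ m ∈ ℝ ] (∀ n → seq m n ℚ.≤ ½) × m ≈ fromℚ ½ * (m * m + b * b) → Goal
  fromRoot (r , r≤½ , r≈) = Pos-square⇒apart {b} b²>0
    where
    μ : ℂ
    μ = fromℝ (- r)

    -- (2 - r , -b) solves the second row identically and the first by the equation for r. Unlike (b
    -- , -r), taken from the first row, it is visibly nonzero even when b is 0, as 2 - r ≥ 3/2.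
    u : Fin 2 → ℂ
    u zero       = fromℝ (fromℚ 2ℚ + - r)
    u (suc zero) = fromℝ (- b)

    residual : ℝ
    residual = r + - (fromℚ ½ * (r * r + b * b))

    -- Twice the residual is r (2 - r) - b²; it settles both the first row of the eigenvector
    -- equation and the positivity of b².
    2residual≈0 : fromℚ 2ℚ * residual ≈ 0ℝ
    2residual≈0 = *-zeroʳ-≈ (fromℚ 2ℚ) {residual} (≈⇒-≈0 {r} {fromℚ ½ * (r * r + b * b)} r≈)

    u-eigen : ∀ a → rowValue b a (u zero) (u (suc zero)) ≈ᶜ μ *ᶜ u a
    u-eigen zero =
      -≈0⇒≈ {re (fromℝ b *ᶜ fromℝ (- b))} {re (μ *ᶜ u zero)}
        (≈0-resp {fromℚ 2ℚ * residual} {re (fromℝ b *ᶜ fromℝ (- b)) + - re (μ *ᶜ u zero)}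
          (λ n → solve 2 (λ r b → con 2ℚ :* (r :+ :- (con ½ :* (r :* r :+ b :* b)))
             := (b :* (:- b) :+ :- (con 0ℚ :* con 0ℚ)) :+ :- ((:- r) :* (con 2ℚ :+ :- r) :+ :- (con 0ℚ :* con 0ℚ))) refl
             (seq r n) (seq b n))
          2residual≈0) ,
      ≈-pointwise {im (fromℝ b *ᶜ fromℝ (- b))} {im (μ *ᶜ u zero)}
        (λ n → solve 2 (λ r b → b :* con 0ℚ :+ con 0ℚ :* (:- b) := (:- r) :* con 0ℚ :+ con 0ℚ :* (con 2ℚ :+ :- r)) refl
          (seq r n) (seq b n))
    u-eigen (suc zero) = ≈ᶜ-pointwise {rowValue b (suc zero) (u zero) (u (suc zero))} {μ *ᶜ u (suc zero)}
      (λ n → solve 2 (λ r b →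
          ((:- b) :* (con 2ℚ :+ :- r) :+ :- (con 0ℚ :* con 0ℚ)) :+ (con (ℚ.- 2ℚ) :* (:- b) :+ :- (con 0ℚ :* con 0ℚ))
          := (:- r) :* (:- b) :+ :- (con 0ℚ :* con 0ℚ)) refl (seq r n) (seq b n))
      (λ n → solve 2 (λ r b →
          ((:- b) :* con 0ℚ :+ con 0ℚ :* (con 2ℚ :+ :- r)) :+ (con (ℚ.- 2ℚ) :* con 0ℚ :+ con 0ℚ :* (:- b))
          := (:- r) :* con 0ℚ :+ con 0ℚ :* (:- b)) refl (seq r n) (seq b n))

    0-eigen : ∀ b′ a → rowValue b′ a 0ᶜ 0ᶜ ≈ᶜ μ *ᶜ 0ᶜ
    0-eigen b′ zero = ≈ᶜ-pointwise {rowValue b′ zero 0ᶜ 0ᶜ} {μ *ᶜ 0ᶜ}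
      (λ n → solve 2 (λ r b → b :* con 0ℚ :+ :- (con 0ℚ :* con 0ℚ) := (:- r) :* con 0ℚ :+ :- (con 0ℚ :* con 0ℚ)) refl (seq r n) (seq b′ n))
      (λ n → solve 2 (λ r b → b :* con 0ℚ :+ con 0ℚ :* con 0ℚ := (:- r) :* con 0ℚ :+ con 0ℚ :* con 0ℚ) refl (seq r n) (seq b′ n))
    0-eigen b′ (suc zero) = ≈ᶜ-pointwise {rowValue b′ (suc zero) 0ᶜ 0ᶜ} {μ *ᶜ 0ᶜ}
      (λ n → solve 2 (λ r b → ((:- b) :* con 0ℚ :+ :- (con 0ℚ :* con 0ℚ)) :+ (con (ℚ.- 2ℚ) :* con 0ℚ :+ :- (con 0ℚ :* con 0ℚ))
         := (:- r) :* con 0ℚ :+ :- (con 0ℚ :* con 0ℚ)) refl (seq r n) (seq b′ n))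
      (λ n → solve 2 (λ r b → ((:- b) :* con 0ℚ :+ con 0ℚ :* con 0ℚ) :+ (con (ℚ.- 2ℚ) :* con 0ℚ :+ con 0ℚ :* con 0ℚ)
         := (:- r) :* con 0ℚ :+ con 0ℚ :* con 0ℚ) refl (seq r n) (seq b′ n))

    local : Fin 2 × Fin m → ℂ
    local (a , l) = select l k (u a) 0ᶜ

    v : Vector ℂ (2 ℕ.* m)
    v i = local (remQuot {2} m i)

    v-on : ∀ a → v (combine {2} a k) ≡ u a
    v-on a = trans (cong local (Finₚ.remQuot-combine {2} a k)) (select-≡ k)

    v-off : ∀ {l} → l ≢ k → ∀ a → v (combine {2} a l) ≡ 0ᶜ
    v-off {l} l≢k a = trans (cong local (Finₚ.remQuot-combine {2} a l)) (select-≢ l≢k)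

    Eigen : Fin (2 ℕ.* m) → Set
    Eigen i = (A · v) i ≈ᶜ μ *ᶜ v i

    from-local : ∀ l (z : Fin 2 → ℂ) → (∀ a → v (combine {2} a l) ≡ z a) →
      (∀ a → rowValue (β l) a (z zero) (z (suc zero)) ≈ᶜ μ *ᶜ z a) → ∀ a → Eigen (combine {2} a l)
    from-local l z v≡z z-eigen a = ≈ᶜ-trans
      {(A · v) (combine {2} a l)}
      {rowValue (β l) a (v (combine {2} zero l)) (v (combine {2} (suc zero) l))}
      {μ *ᶜ v (combine {2} a l)}
      (rows v a l)
      (subst₂ _≈ᶜ_ (sym (cong₂ (rowValue (β l) a) (v≡z zero) (v≡z (suc zero))))
                   (sym (cong (μ *ᶜ_) (v≡z a))) (z-eigen a))

    by-case : ∀ a l → Dec (l ≡ k) → Eigen (combine {2} a l)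
    by-case a l (yes refl) = from-local k u v-on u-eigen a
    by-case a l (no l≢k)   = from-local l (λ _ → 0ᶜ) (v-off l≢k) (0-eigen (β l)) a

    2-r>0 : Pos (fromℚ 2ℚ + - r)
    2-r>0 = Pos-resp {fromℚ (1ℚ ℚ.+ ½) + (h + - r)} {fromℚ 2ℚ + - r}
      (λ n → solve 1 (λ r → con (1ℚ ℚ.+ ½) :+ (con ½ :+ :- r) := con 2ℚ :+ :- r) refl (seq r n))
      (Pos-+-nonNeg {fromℚ (1ℚ ℚ.+ ½)} {h + - r} (Pos-const (ℚₚ.positive⁻¹ (1ℚ ℚ.+ ½))) (λ n → ≤⇒0≤- (r≤½ n)))

    v≢0 : ¬ (∀ i → v i ≈ᶜ 0ᶜ)
    v≢0 v≈0 = ¬Pos-0 (Pos-resp-≈ {fromℚ 2ℚ + - r} {0ℝ}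
      (proj₁ (subst (_≈ᶜ 0ᶜ) (v-on zero) (v≈0 (combine {2} zero k)))) 2-r>0)

    r>0 : Pos r
    r>0 = Pos-resp { - - r} {r} (λ n → solve 1 (λ r → :- (:- r) := r) refl (seq r n))
      (<0⇒Neg { - r} (stable μ (v , v≢0 , ∀-combine {m} {Eigen} λ a l → by-case a l (l Finₚ.≟ k))))

    b²>0 : Pos (b * b)
    b²>0 = Pos-resp-≈ {r * (fromℚ 2ℚ + - r)} {b * b}
      (-≈0⇒≈ {r * (fromℚ 2ℚ + - r)} {b * b}
        (≈0-resp {fromℚ 2ℚ * residual} {r * (fromℚ 2ℚ + - r) + - (b * b)}
          (λ n → solve 2 (λ r b → con 2ℚ :* (r :+ :- (con ½ :* (r :* r :+ b :* b))) := r :* (con 2ℚ :+ :- r) :+ :- (b :* b)) refl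
            (seq r n) (seq b n))
          2residual≈0))
      (Pos-* {r} {fromℚ 2ℚ + - r} r>0 2-r>0)

  near : Pos (b + h) → Pos (h + - b) → Goal
  near b+h>0 h-b>0 = fromRoot (small-root b (Pos-resp {(b + h) * (h + - b)} {fromℚ (½ ℚ.* ½) + - (b * b)}
    (λ n → solve 1 (λ b → (b :+ con ½) :* (con ½ :+ :- b) := con (½ ℚ.* ½) :+ :- (b :* b)) refl (seq b n))
    (Pos-* {b + h} {h + - b} b+h>0 h-b>0)))

  below : Pos (b + h) → Pos (h + - b) ⊎ Pos b → Goal
  below b+h>0 (inj₁ h-b>0) = near b+h>0 h-b>0
  below b+h>0 (inj₂ b>0)   = inj₁ b>0

  above : Pos (b + h) ⊎ Pos (- b) → Goal
  above (inj₂ b<0)   = inj₂ b<0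
  above (inj₁ b+h>0) = below b+h>0 (Pos-cotrans {h + - b} {b}
    (Pos-resp {h} {h + - b + b} (λ n → solve 1 (λ b → con ½ := con ½ :+ :- b :+ b) refl (seq b n)) (Pos-const 0<½)))

-- The intervals between consecutive excluded points

Component : ∀ {m} → Fin (suc m) → Pred ℝ 0ℓ
Component {m} i x = x < 0ℝ × (∀ (k : Fin m) → toℕ k ℕ.< toℕ i → Pos (- β k x))
                           × (∀ (k : Fin m) → toℕ i ℕ.≤ toℕ k → Pos (β k x))

-- Components are numbered from right to left: `Component i` lies between -(i + 1) and -i, and the
-- last one is unbounded below. The point -(i + ½) belongs to it in either case, with margin ½ at
-- each excluded point.
midpoint : ℕ → ℝ
midpoint i = fromℚ (ℚ.- (ι i ℚ.+ ½))

midpoint∈ : ∀ {m} (i : Fin (suc m)) → midpoint (toℕ i) ∈ Component {m} i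
midpoint∈ {m} i = Neg⇒<0 {midpoint (toℕ i)} (Pos-resp {h + fromℚ (ι (toℕ i))} { - midpoint (toℕ i)}
    (λ n → solve 1 (λ p → con ½ :+ p := :- (:- (p :+ con ½))) refl (ι (toℕ i)))
    (Pos-+-nonNeg {h} {fromℚ (ι (toℕ i))} (Pos-const 0<½) λ n → 0≤ι (toℕ i))) ,
  (λ k k<i → Pos-resp {h + fromℚ (ι (toℕ i) ℚ.- ι (suc (toℕ k)))} { - β k (midpoint (toℕ i))}
    (λ n → solve 2 (λ p q → con ½ :+ (p :- q) := :- (:- (p :+ con ½) :+ q)) refl (ι (toℕ i)) (ι (suc (toℕ k))))
    (Pos-+-nonNeg {h} {fromℚ (ι (toℕ i) ℚ.- ι (suc (toℕ k)))} (Pos-const 0<½) λ n → ≤⇒0≤- (ι-mono-≤ k<i))) ,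
  (λ k i≤k → Pos-resp {h + fromℚ (ι (toℕ k) ℚ.- ι (toℕ i))} {β k (midpoint (toℕ i))}
    (λ n → solve 2 (λ p q → con ½ :+ (q :- p) := :- (p :+ con ½) :+ (con 1ℚ :+ q)) refl (ι (toℕ i)) (ι (toℕ k)))
    (Pos-+-nonNeg {h} {fromℚ (ι (toℕ k) ℚ.- ι (toℕ i))} (Pos-const 0<½) λ n → ≤⇒0≤- (ι-mono-≤ i≤k)))
  where
  h : ℝ
  h = fromℚ ½

-- `x ≤ y` is only a negation. Splitting f = g + (x - y) by cotransitivity leaves g > 0, since x - y
-- > 0 is exactly what it refutes.
≤-Pos-transfer : ∀ {x y f g} → x ≤ y → (∀ n → seq f n ≡ seq g n ℚ.+ (seq x n ℚ.- seq y n)) → Pos f → Pos g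
≤-Pos-transfer {x} {y} {f} {g} x≤y f≡ f>0 = [ id , (λ h → ⊥-elim (x≤y (Pos⇒< {y} {x} h))) ]′
  (Pos-cotrans {g} {x + - y} (Pos-resp {f} {g + (x + - y)} f≡ f>0))

Component-interval : ∀ {m} (i : Fin (suc m)) → IsInterval (Component {m} i)
Component-interval i x y z (_ , _ , x-above) (z<0 , z-below , _) x≤y y≤z =
  Neg⇒<0 {y} (≤-Pos-transfer {y} {z} { - z} { - y} y≤z
    (λ n → solve 2 (λ y z → :- z := :- y :+ (y :- z)) refl (seq y n) (seq z n)) (<0⇒Neg {z} z<0)) ,
  (λ k k<i → ≤-Pos-transfer {y} {z} { - β k z} { - β k y} y≤z
    (λ n → solve 3 (λ y z p → :- (z :+ p) := :- (y :+ p) :+ (y :- z)) refl (seq y n) (seq z n) (ι (suc (toℕ k)))) (z-below k k<i)) ,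
  (λ k i≤k → ≤-Pos-transfer {x} {y} {β k x} {β k y} x≤y
    (λ n → solve 3 (λ x y p → x :+ p := (y :+ p) :+ (x :- y)) refl (seq x n) (seq y n) (ι (suc (toℕ k)))) (x-above k i≤k))

Pos∧Neg⇒⊥ : ∀ {x} → Pos x → Pos (- x) → ⊥
Pos∧Neg⇒⊥ {x} x>0 x<0 = ¬Pos-0 (Pos-resp {x + - x} {0ℝ} (λ n → ℚₚ.+-inverseʳ (seq x n)) (Pos-+ {x} { - x} x>0 x<0))

Pos-square : ∀ {x} → Pos x ⊎ Pos (- x) → Pos (x * x)
Pos-square {x} (inj₁ x>0) = Pos-* {x} {x} x>0 x>0
Pos-square {x} (inj₂ x<0) = Pos-resp {(- x) * (- x)} {x * x}
  (λ n → solve 1 (λ x → (:- x) :* (:- x) := x :* x) refl (seq x n)) (Pos-* { - x} { - x} x<0 x<0)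

Component⊆region : ∀ {m} (i : Fin (suc m)) → Component {m} i ⊆ StabilityRegion (F m) (H m)
Component⊆region {m} i {x} (x<0 , below , above) = x<0 , apart⇒stable {m} (λ k → β k x) (pencil (F m) (H m) x) (row {m} x) λ k →
  Pos-square {β k x} ([ inj₂ ∘ below k , inj₁ ∘ above k ]′ (ℕₚ.<-≤-connex (toℕ k) (toℕ i)))

-- `i` is the first index at which the given choice falls on `Q`, or `m` if there is none;
-- monotonicity carries `Q` to all later indices even where the choice there was `P`.
threshold : ∀ {m} {P Q : Fin m → Set} → (∀ k → Q k ⊎ P k) →
  (∀ {k l} → toℕ k ℕ.≤ toℕ l → Q k → Q l) →
  Σ[ i ∈ Fin (suc m) ] (∀ k → toℕ k ℕ.< toℕ i → P k) × (∀ k → toℕ i ℕ.≤ toℕ k → Q k)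
threshold {zero}  _ _ = zero , (λ ()) , (λ ())
threshold {suc m} {P} {Q} d mono = start (d zero)
  where
  Goal : Set
  Goal = Σ[ i ∈ Fin (suc (suc m)) ] (∀ k → toℕ k ℕ.< toℕ i → P k) × (∀ k → toℕ i ℕ.≤ toℕ k → Q k)

  start : Q zero ⊎ P zero → Goal
  start (inj₁ q) = zero , (λ _ ()) , λ k _ → mono ℕ.z≤n q
  start (inj₂ p) = extend (threshold {m} {P ∘ suc} {Q ∘ suc} (d ∘ suc) (mono ∘ ℕ.s≤s))
    where
    extend : Σ[ i ∈ Fin (suc m) ] (∀ k → toℕ k ℕ.< toℕ i → P (suc k)) × (∀ k → toℕ i ℕ.≤ toℕ k → Q (suc k)) → Goal
    extend (i , lo , hi) = suc i ,
      (λ { zero _ → p ; (suc k) (ℕ.s≤s k<i) → lo k k<i }) ,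
      (λ { (suc k) (ℕ.s≤s i≤k) → hi k i≤k })

β-mono : ∀ {m} {k l : Fin m} x → toℕ k ℕ.≤ toℕ l → Pos (β k x) → Pos (β l x)
β-mono {m} {k} {l} x k≤l βk>0 = Pos-resp {β k x + fromℚ (ι (suc (toℕ l)) ℚ.- ι (suc (toℕ k)))} {β l x}
  (λ n → solve 3 (λ x p q → (x :+ p) :+ (q :- p) := x :+ q) refl (seq x n) (ι (suc (toℕ k))) (ι (suc (toℕ l))))
  (Pos-+-nonNeg {β k x} {fromℚ (ι (suc (toℕ l)) ℚ.- ι (suc (toℕ k)))} βk>0 λ n → ≤⇒0≤- (ι-mono-≤ (ℕ.s≤s k≤l)))

region-covered : ∀ {m} x → x ∈ StabilityRegion (F m) (H m) → ∃[ i ] x ∈ Component {m} i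
region-covered {m} x (x<0 , stable) =
  let i , lo , hi = threshold {m} {λ k → Pos (- β k x)} {λ k → Pos (β k x)} (stable⇒apart {m} (λ k → β k x) (pencil (F m) (H m) x) (row {m} x) stable) (λ {k} {l} → β-mono {m} {k} {l} x)
  in i , x<0 , lo , hi

-- For i < j the point -(i + 1), where β i vanishes, lies between the two components.
separator : ∀ {m} {i j : Fin (suc m)} → toℕ i ℕ.< toℕ j → ∃[ k ] (toℕ i ≡ toℕ {m} k)
separator {m} {i} {j} i<j = fromℕ< i<m , sym (Finₚ.toℕ-fromℕ< i<m)
  where
  i<m : toℕ i ℕ.< m
  i<m = ℕₚ.<-≤-trans i<j (ℕ.s≤s⁻¹ (Finₚ.toℕ<n j))

Component-disjoint : ∀ {m} {i j : Fin (suc m)} → toℕ i ℕ.< toℕ j → ∀ x → x ∈ Component {m} i → x ∈ Component {m} j → ⊥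
Component-disjoint {m} {i} {j} i<j x (_ , _ , above) (_ , below , _) =
  let k , i≡k = separator {m} {i} {j} i<j in
  Pos∧Neg⇒⊥ {β k x} (above k (ℕₚ.≤-reflexive i≡k)) (below k (subst (ℕ._< toℕ j) i≡k i<j))

gap : ∀ {m} {i j : Fin (suc m)} → toℕ i ℕ.< toℕ j → ∀ {T : Pred ℝ 0ℓ} → IsInterval T → T ⊆ StabilityRegion (F m) (H m) →
  ∀ {x y} → x ∈ T → y ∈ T → x ∈ Component {m} i → y ∈ Component {m} j → ⊥
gap {m} {i} {j} i<j {T} interval T⊆S {x} {y} x∈T y∈T (_ , _ , above) (_ , below , _) =
  -- Convexity forces p into `T`, hence into the region; stability there would make β k p apart from
  -- 0, although it is 0.
  [ βp≯0 , -βp≯0 ]′ (stable⇒apart {m} (λ k → β k p) (pencil (F m) (H m) p) (row {m} p) (proj₂ (T⊆S (interval y p x y∈T x∈T y≤p p≤x))) k)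
  where
  k : Fin m
  k = proj₁ (separator {m} {i} {j} i<j)
  i≡k : toℕ i ≡ toℕ k
  i≡k = proj₂ (separator {m} {i} {j} i<j)
  q : ℚ
  q = ι (suc (toℕ k))
  p : ℝ
  p = fromℚ (ℚ.- q)

  y≤p : y ≤ p
  y≤p p<y = Pos∧Neg⇒⊥ {β k y}
    (Pos-resp {y + - p} {β k y} (λ n → solve 2 (λ y q → y :+ :- (:- q) := y :+ q) refl (seq y n) q) (<⇒Pos {p} {y} p<y))
    (below k (subst (ℕ._< toℕ j) i≡k i<j))

  p≤x : p ≤ x
  p≤x x<p = Pos∧Neg⇒⊥ {β k x} (above k (ℕₚ.≤-reflexive i≡k))
    (Pos-resp {p + - x} { - β k x} (λ n → solve 2 (λ x q → :- q :+ :- x := :- (x :+ q)) refl (seq x n) q) (<⇒Pos {x} {p} x<p))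

  βp≯0 : ¬ Pos (β k p)
  βp≯0 h = ¬Pos-0 (Pos-resp {β k p} {0ℝ} (λ n → ℚₚ.+-inverseˡ q) h)

  -βp≯0 : ¬ Pos (- β k p)
  -βp≯0 h = ¬Pos-0 (Pos-resp { - β k p} {0ℝ} (λ n → cong ℚ.-_ (ℚₚ.+-inverseˡ q)) h)

-- `T` contains the midpoint of component `i`, so a point of `T` located in any other component
-- would make `T` cross an excluded point.
Component-maximal : ∀ {m} (i : Fin (suc m)) (T : Pred ℝ 0ℓ) → IsInterval T → T ⊆ StabilityRegion (F m) (H m) →
  Component {m} i ⊆ T → T ⊆ Component {m} i
Component-maximal {m} i T interval T⊆S C⊆T {x} x∈T = locate (region-covered {m} x (T⊆S x∈T))
  where
  y : ℝ
  y = midpoint (toℕ i)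
  y∈C : y ∈ Component {m} i
  y∈C = midpoint∈ {m} i

  locate : ∃[ j ] x ∈ Component {m} j → x ∈ Component {m} i
  locate (j , x∈Cⱼ) = compare (Finₚ.<-cmp i j)
    where
    compare : _ → x ∈ Component {m} i
    compare (tri< i<j _ _)  = ⊥-elim (gap {m} {i} {j} i<j {T} interval T⊆S {y} {x} (C⊆T {y} y∈C) x∈T y∈C x∈Cⱼ)
    compare (tri≈ _ refl _) = x∈Cⱼ
    compare (tri> _ _ j<i)  = ⊥-elim (gap {m} {j} {i} j<i {T} interval T⊆S {x} {y} x∈T (C⊆T {y} y∈C) x∈Cⱼ y∈C)

Components-disjoint : ∀ {m} (i j : Fin (suc m)) → i ≢ j → ∀ x → x ∈ Component {m} i → x ∈ Component {m} j → ⊥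
Components-disjoint {m} i j i≢j x x∈Cᵢ x∈Cⱼ = compare (Finₚ.<-cmp i j)
  where
  compare : _ → ⊥
  compare (tri< i<j _ _) = Component-disjoint {m} {i} {j} i<j x x∈Cᵢ x∈Cⱼ
  compare (tri≈ _ i≡j _) = i≢j i≡j
  compare (tri> _ _ j<i) = Component-disjoint {m} {j} {i} j<i x x∈Cⱼ x∈Cᵢ

regions : ∀ m → HasDisconnectedStableRegions (F m) (H m) (suc m)
regions m = record
  { component   = Component {m}
  ; isComponent = λ i → record
    { nonempty = midpoint (toℕ i) , midpoint∈ {m} i
    ; interval = Component-interval {m} i
    ; subset   = λ {x} → Component⊆region {m} i {x}
    ; maximal  = λ T interval T⊆S C⊆T {x} → Component-maximal {m} i T interval T⊆S C⊆T {x}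
    }
  ; disjoint    = Components-disjoint {m}
  ; covers      = region-covered {m}
  }

theorem1 : ∀ (n : ℕ) → n ℕ.≥ 1 →
    Σ[ F ∈ Matrix (2 ℕ.* (n ℕ.∸ 1)) ] Σ[ H ∈ Matrix (2 ℕ.* (n ℕ.∸ 1)) ]
    HasDisconnectedStableRegions F H n
theorem1 (suc m) _ = subst
  (λ k → Σ[ F ∈ Matrix k ] Σ[ H ∈ Matrix k ] HasDisconnectedStableRegions F H (suc m))
  order (F m , H m , regions m)
  where
  -- The orders are equal definitionally, but converting the whole statement along
  -- that equality would unfold the Cauchy proofs inside the matrix entries.
  order : 2 ℕ.* m ≡ 2 ℕ.* (suc m ℕ.∸ 1)
  order = refl
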